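{- Let $c_1$ and $c_2$ be distinct Boolean connectives. Then $\mathcal{B}_{c_1}\bullet\mathcal{B}_{c_2}=\mathcal{B}_{c_1c_2}$ if and only if at least one of the following holds: (a) at least one among $c_1$ and $c_2$ is top-like; (b) neither $c_1$ nor $c_2$ is very significant; (c) $c_1\in\mathcal{C}^{\leftrightarrow}$ and $c_2=\bot$, or $c_1=\bot$ and $c_2\in\mathcal{C}^{\leftrightarrow}$.
   Context: Fix a denumerable set $P=\{p_1,p_2,\dots\}$ of sentential variables. A signature $\Sigma$ is a set of connective symbols, each with an arity in $\{0,1,2,\dots\}$; $L_\Sigma(P)$ is the set of formulas freely generated by $P$ over $\Sigma$. A logic over $L_\Sigma(P)$ is a pair $\langle L_\Sigma(P),\vdash\rangle$ with $\vdash\,\subseteq \mathcal{P}(L_\Sigma(P))\times L_\Sigma(P)$ satisfying: (R) $\Gamma\cup\{C\}\vdash C$; (M) $\Gamma\vdash C$ implies $\Gamma\cup\Delta\vdash C$; (T) if $\Gamma\vdash D$ for all $D\in\Delta$ and $\Gamma\cup\Delta\vdash C$, then $\Gamma\vdash C$; (SI) $\Gamma\vdash C$ implies $\Gamma^\sigma\vdash C^\sigma$ for every substitution $\sigma:P\to L_\Sigma(P)$. The fibring $\mathcal{L}_a\bullet\mathcal{L}_b$ of logics $\mathcal{L}_a=\langle L_{\Sigma_a}(P),\vdash_a\rangle$ and $\mathcal{L}_b=\langle L_{\Sigma_b}(P),\vdash_b\rangle$ is the logic over $L_{\Sigma_a\cup\Sigma_b}(P)$ whose consequence relation is the smallest one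 (satisfying R, M, T, SI over that language) that includes both $\vdash_a$ and $\vdash_b$. A Boolean (or classical) connective is a connective symbol of some arity $k\geq 0$ together with a fixed interpretation $\{0,1\}^k\to\{0,1\}$; "distinct" connectives are distinct symbols. For a set $K$ of Boolean connectives, $\mathcal{B}_K=\langle L_K(P),\vdash_K\rangle$ is the two-valued logic given by: $\Gamma\vdash_K C$ iff every valuation $v:L_K(P)\to\{0,1\}$ respecting the interpretations of the connectives and satisfying $v(G)=1$ for all $G\in\Gamma$ also satisfies $v(C)=1$. We write $\mathcal{B}_{c}=\mathcal{B}_{\{c\}}$ and $\mathcal{B}_{c_1c_2}=\mathcal{B}_{\{c_1,c_2\}}$. The symbol $\bot$ denotes the nullary connective interpreted as $0$. Let $c$ be a $k$-place Boolean connective and $\vdash$ the consequence relation of $\mathcal{B}_c$. $c$ is top-like if $\varnothing\vdash c(p_1,\dots,p_k)$; bottom-like if $c(p_1,\dots,p_k)\vdash p_{k+1}$; a projection-conjunction if there is $J\subseteq\{1,\dots,k\}$ with $c(p_1,\dots,p_k)\vdash p_j$ for every $j\in J$ and $\{p_j:j\in J\}\vdash c(p_1,\dots,p_k)$ (top-like connectives are the case $J=\varnothing$). $c$ is very significant if it is neither bottom-like nor a projection-conjunction. $\mathcal{C}^{\leftrightarrow}$ is the clone of operations on $\{0,1\}$ generated by bi-implication $\leftrightarrow$ (value $1$ iff the two arguments are equal), i.e. all operations of positive arity obtained from $\leftrightarrow$ and projections by composition; "$c\in\mathcal{C}^{\leftrightarrow}$" means that the interpretation of $c$ belongs to it (a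 nullary connective being viewed as a constant unary function). -}

module Defs where

open import Data.Bool.Base using (Bool; true; false)
import Data.Bool.Properties as Bool
open import Data.Fin.Base using (Fin; toℕ)
open import Data.Fin.Subset as Subset using (Subset)
open import Data.Nat.Base using (ℕ; zero; suc)
open import Data.Product.Base using (∃-syntax; _×_; _,_; proj₁; proj₂)
open import Data.Sum.Base using (_⊎_; inj₁; inj₂; [_,_]′)
open import Data.Unit.Base using (⊤; tt)
open import Data.Vec.Base using (Vec; []; _∷_; map; lookup; tabulate)
open import Function.Bundles using (_⇔_)
open import Level using (Level; 0ℓ; _⊔_) renaming (suc to lsuc)
open import Relation.Binary.PropositionalEquality
  using (_≡_; refl; trans; cong; _≗_)
open import Relation.Nullary.Decidable.Core using (does)
open import Relation.Nullary.Negation.Core using (¬_)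
open import Relation.Unary using (Pred; _∈_; _≐_; _∪_; ∅; ｛_｝)

private
  variable
    ℓ ℓa ℓb : Level

------------------------------------------------------------------------
-- Formulas

record Signature : Set₁ where
  field
    Symbol : Set
    arity  : Symbol → ℕ

open Signature public

-- The symbols of the two signatures are tagged, so this is the union of
-- two signatures that have no symbol in common.

infixr 6 _∪ˢ_

_∪ˢ_ : Signature → Signature → Signature
Σa ∪ˢ Σb = record
  { Symbol = Symbol Σa ⊎ Symbol Σb
  ; arity  = [ arity Σa , arity Σb ]′
  }

-- var i is the sentential variable written p_{i+1} on paper.

data Form (Σ : Signature) : Set where
  var : ℕ → Form Σ
  op  : (s : Symbol Σ) → Vec (Form Σ) (arity Σ s) → Form Σ

FormSet : Signature → Set₁
FormSet Σ = Pred (Form Σ) 0ℓ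

module _ {Σ : Signature} where

  infixl 8 _[_] _[_]*

  _[_]  : Form Σ → (ℕ → Form Σ) → Form Σ
  _[_]* : ∀ {n} → Vec (Form Σ) n → (ℕ → Form Σ) → Vec (Form Σ) n

  var i   [ σ ] = σ i
  op s As [ σ ] = op s (As [ σ ]*)

  []       [ σ ]* = []
  (A ∷ As) [ σ ]* = A [ σ ] ∷ As [ σ ]*

module _ {Σa Σb : Signature} where

  inˡ  : Form Σa → Form (Σa ∪ˢ Σb)
  inˡ* : ∀ {n} → Vec (Form Σa) n → Vec (Form (Σa ∪ˢ Σb)) n

  inˡ (var i)   = var i
  inˡ (op s As) = op (inj₁ s) (inˡ* As)

  inˡ* []       = []
  inˡ* (A ∷ As) = inˡ A ∷ inˡ* As

  inʳ  : Form Σb → Form (Σa ∪ˢ Σb)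
  inʳ* : ∀ {n} → Vec (Form Σb) n → Vec (Form (Σa ∪ˢ Σb)) n

  inʳ (var i)   = var i
  inʳ (op s As) = op (inj₂ s) (inʳ* As)

  inʳ* []       = []
  inʳ* (A ∷ As) = inʳ A ∷ inʳ* As

image : {A B : Set} → (A → B) → Pred A 0ℓ → Pred B 0ℓ
image f Γ b = ∃[ a ] (a ∈ Γ × b ≡ f a)

------------------------------------------------------------------------
-- Logics

Consequence : Signature → (ℓ : Level) → Set (lsuc 0ℓ ⊔ lsuc ℓ)
Consequence Σ ℓ = FormSet Σ → Form Σ → Set ℓ

record IsConsequence {Σ : Signature} (_⊢_ : Consequence Σ ℓ)
                     : Set (lsuc 0ℓ ⊔ ℓ) where
  field
    -- Sets of formulas are predicates, whose equality is _≐_ .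
    resp : ∀ {Γ Δ C} → Γ ≐ Δ → Γ ⊢ C → Δ ⊢ C
    R    : ∀ {Γ C} → (Γ ∪ ｛ C ｝) ⊢ C
    M    : ∀ {Γ Δ C} → Γ ⊢ C → (Γ ∪ Δ) ⊢ C
    T    : ∀ {Γ Δ C} → (∀ {D} → D ∈ Δ → Γ ⊢ D) → (Γ ∪ Δ) ⊢ C → Γ ⊢ C
    SI   : ∀ {Γ C} (σ : ℕ → Form Σ) → Γ ⊢ C → image (_[ σ ]) Γ ⊢ (C [ σ ])

record Logic (Σ : Signature) (ℓ : Level) : Set (lsuc 0ℓ ⊔ lsuc ℓ) where
  field
    _⊢_           : Consequence Σ ℓ
    isConsequence : IsConsequence _⊢_

infix 4 _∶_⊢_ _≋_

_∶_⊢_ : {Σ : Signature} → Logic Σ ℓ → Consequence Σ ℓ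
𝓛 ∶ Γ ⊢ C = Logic._⊢_ 𝓛 Γ C

_≋_ : {Σ : Signature} → Logic Σ ℓa → Logic Σ ℓb → Set (lsuc 0ℓ ⊔ ℓa ⊔ ℓb)
𝓛 ≋ 𝓜 = ∀ Γ C → (𝓛 ∶ Γ ⊢ C) ⇔ (𝓜 ∶ Γ ⊢ C)

------------------------------------------------------------------------
-- Fibring

module _ {Σa Σb : Signature} (𝓛a : Logic Σa ℓa) (𝓛b : Logic Σb ℓb) where

  private
    Σ : Signature
    Σ = Σa ∪ˢ Σb

  -- The smallest consequence relation including both given ones is
  -- obtained by inductive generation; see •-least below.

  data Fib : FormSet Σ → Form Σ → Set (lsuc 0ℓ ⊔ ℓa ⊔ ℓb) where
    inclˡ : ∀ {Γ C} → 𝓛a ∶ Γ ⊢ C → Fib (image inˡ Γ) (inˡ C)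
    inclʳ : ∀ {Γ C} → 𝓛b ∶ Γ ⊢ C → Fib (image inʳ Γ) (inʳ C)
    resp  : ∀ {Γ Δ C} → Γ ≐ Δ → Fib Γ C → Fib Δ C
    R     : ∀ {Γ C} → Fib (Γ ∪ ｛ C ｝) C
    M     : ∀ {Γ Δ C} → Fib Γ C → Fib (Γ ∪ Δ) C
    T     : ∀ {Γ Δ C} → (∀ {D} → D ∈ Δ → Fib Γ D) → Fib (Γ ∪ Δ) C → Fib Γ C
    SI    : ∀ {Γ C} (σ : ℕ → Form Σ) → Fib Γ C →
            Fib (image (_[ σ ]) Γ) (C [ σ ])

  infixr 5 _•_

  _•_ : Logic Σ (lsuc 0ℓ ⊔ ℓa ⊔ ℓb)
  _•_ = record
    { _⊢_           = Fib
    ; isConsequence = record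
      { resp = resp ; R = R ; M = M ; T = T ; SI = SI }
    }

  •-least : {_⊩_ : Consequence Σ ℓ} → IsConsequence _⊩_ →
            (∀ {Γ C} → 𝓛a ∶ Γ ⊢ C → image inˡ Γ ⊩ inˡ C) →
            (∀ {Γ C} → 𝓛b ∶ Γ ⊢ C → image inʳ Γ ⊩ inʳ C) →
            ∀ {Γ C} → _•_ ∶ Γ ⊢ C → Γ ⊩ C
  •-least {_⊩_ = _⊩_} ⊩-isConsequence ⊩-a ⊩-b = go
    where
    module ⊩ = IsConsequence ⊩-isConsequence

    go : ∀ {Γ C} → Fib Γ C → Γ ⊩ C
    go (inclˡ d)  = ⊩-a d
    go (inclʳ d)  = ⊩-b d
    go (resp e d) = ⊩.resp e (go d)
    go R          = ⊩.R
    go (M d)      = ⊩.M (go d)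
    go (T ds d)   = ⊩.T (λ D∈Δ → go (ds D∈Δ)) (go d)
    go (SI σ d)   = ⊩.SI σ (go d)

------------------------------------------------------------------------
-- Boolean connectives and two-valued logics

Op : ℕ → Set
Op k = Vec Bool k → Bool

record Connective : Set where
  constructor connective
  field
    places : ℕ
    interp : Op places

open Connective public

-- A set of connective symbols with fixed interpretations.

record Connectives : Set₁ where
  field
    signature : Signature
    ⟦_⟧       : (s : Symbol signature) → Op (arity signature s)

open Connectives public

⟨_⟩ : Connective → Connectives
⟨ c ⟩ = record
  { signature = record { Symbol = ⊤ ; arity = λ _ → places c }
  ; ⟦_⟧       = λ _ → interp c
  }

-- As with _∪ˢ_ , symbols on the two sides are distinct, even when they
-- have the same interpretation.

infixr 6 _∪ᶜ_

_∪ᶜ_ : Connectives → Connectives → Connectives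
K ∪ᶜ K′ = record
  { signature = signature K ∪ˢ signature K′
  ; ⟦_⟧       = λ where
      (inj₁ s) → ⟦ K ⟧ s
      (inj₂ s) → ⟦ K′ ⟧ s
  }

module _ (K : Connectives) where

  record Valuation : Set where
    field
      val    : Form (signature K) → Bool
      val-op : ∀ s As → val (op s As) ≡ ⟦ K ⟧ s (map val As)

  open Valuation public

  _⊨_ : Consequence (signature K) 0ℓ
  Γ ⊨ C = (v : Valuation) → (∀ {G} → G ∈ Γ → val v G ≡ true) → val v C ≡ true

  private
    map-∘[] : (f : Form (signature K) → Bool) (σ : ℕ → Form (signature K)) →
              ∀ {n} (As : Vec (Form (signature K)) n) →
              map f (As [ σ ]*) ≡ map (λ A → f (A [ σ ])) As
    map-∘[] f σ []       = refl
    map-∘[] f σ (A ∷ As) = cong (f (A [ σ ]) ∷_) (map-∘[] f σ As)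

    _∘ᵛ_ : Valuation → (ℕ → Form (signature K)) → Valuation
    v ∘ᵛ σ = record
      { val    = λ A → val v (A [ σ ])
      ; val-op = λ s As → trans (val-op v s (As [ σ ]*))
                                (cong (⟦ K ⟧ s) (map-∘[] (val v) σ As))
      }

  𝓑 : Logic (signature K) 0ℓ
  𝓑 = record
    { _⊢_           = _⊨_
    ; isConsequence = record
      { resp = λ Γ≐Δ Γ⊨C v v⊨Δ → Γ⊨C v (λ G∈Γ → v⊨Δ (proj₁ Γ≐Δ G∈Γ))
      ; R    = λ v v⊨ → v⊨ (inj₂ refl)
      ; M    = λ Γ⊨C v v⊨ → Γ⊨C v (λ G∈Γ → v⊨ (inj₁ G∈Γ))
      ; T    = λ Γ⊨Δ Γ∪Δ⊨C v v⊨Γ → Γ∪Δ⊨C v λ where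
          (inj₁ G∈Γ) → v⊨Γ G∈Γ
          (inj₂ G∈Δ) → Γ⊨Δ G∈Δ v v⊨Γ
      ; SI   = λ σ Γ⊨C v v⊨ → Γ⊨C (v ∘ᵛ σ) (λ G∈Γ → v⊨ (_ , G∈Γ , refl))
      }
    }

------------------------------------------------------------------------
-- Kinds of connectives

module _ (c : Connective) where

  private
    L : Set
    L = Form (signature ⟨ c ⟩)

    p : Fin (places c) → L
    p j = var (toℕ j)

    c⟨p⟩ : L
    c⟨p⟩ = op tt (tabulate p)

  TopLike : Set
  TopLike = 𝓑 ⟨ c ⟩ ∶ ∅ ⊢ c⟨p⟩

  -- var (places c) is the first variable that does not occur in c⟨p⟩.

  BottomLike : Set
  BottomLike = 𝓑 ⟨ c ⟩ ∶ ｛ c⟨p⟩ ｝ ⊢ var (places c)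

  ProjectionConjunction : Set
  ProjectionConjunction = ∃[ J ]
    ((∀ j → j Subset.∈ J → 𝓑 ⟨ c ⟩ ∶ ｛ c⟨p⟩ ｝ ⊢ p j) ×
     (𝓑 ⟨ c ⟩ ∶ image p (Subset._∈ J) ⊢ c⟨p⟩))

  VerySignificant : Set
  VerySignificant = ¬ BottomLike × ¬ ProjectionConjunction

-- Symbols carry no names, so being the connective ⊥ amounts to being
-- nullary and interpreted as 0.

Is⊥ : Connective → Set
Is⊥ c = places c ≡ 0 × (∀ xs → interp c xs ≡ false)

------------------------------------------------------------------------
-- The clone of bi-implication

-- The clone generated by b.  All arities are positive.  The constructor
-- ext is there because operations that agree everywhere need not be
-- propositionally equal.

data Clone {k : ℕ} (b : Op (suc k)) : {n : ℕ} → Op (suc n) → Set where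
  gen  : Clone b b
  proj : ∀ {n} (i : Fin (suc n)) → Clone b (λ xs → lookup xs i)
  comp : ∀ {m n} {f : Op (suc m)} {g : Fin (suc m) → Op (suc n)} →
         Clone b f → (∀ i → Clone b (g i)) →
         Clone b (λ xs → f (tabulate (λ i → g i xs)))
  ext  : ∀ {n} {f g : Op (suc n)} → f ≗ g → Clone b f → Clone b g

iff : Op 2
iff (x ∷ y ∷ []) = does (x Bool.≟ y)

infix 4 _∈𝒞↔

_∈𝒞↔ : Connective → Set
connective zero    f ∈𝒞↔ = Clone iff {0} (λ _ → f [])
connective (suc n) f ∈𝒞↔ = Clone iff f

{-# OPTIONS --safe #-}
module Submission where

-- The theories of the fibring are the sets χ of formulas that are a meet of
-- valuations respecting c₁ and also a meet of valuations respecting c₂, so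
-- the question is whether every such χ is a meet of valuations respecting
-- both.  If c₁ is top-like, valuations respecting c₂ above χ respect c₁; if
-- neither connective is very significant, a proper χ respects both itself;
-- and in case (c) two valuations combine to their bi-implication.
-- Conversely, let u and w respect c₁ while u ∧ w respects c₂.  False formulas
-- headed by c₂ can be falsified in u, in w, or in both, at will.  If c₂ has
-- arguments, this makes equivalent formulas behave differently unless c₁
-- preserves ∧.  If c₂ = ⊥, it forces c₁ either to preserve ∧ or to define ↔
-- (with a true parameter) and then to preserve ↔.

open import Defs
open import Axiom.ExcludedMiddle using (ExcludedMiddle)
open import Data.Bool.Base using (Bool; true; false; _∧_; not; if_then_else_)
open import Data.Bool.Properties
  using (∧-conicalˡ; ∧-conicalʳ; ∧-identityˡ; ∧-identityʳ; ∧-zeroʳ; ∧-idem; ∧-comm;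
         ¬-not; ⇔→≡)
open import Data.Fin.Base as Fin using (Fin; toℕ)
open import Data.Nat.Base as ℕ using (ℕ; _*_)
open import Data.Nat.Properties using (even≢odd; *-cancelˡ-≡; suc-injective)
open import Data.Product.Base using (∃; ∃-syntax; _×_; _,_; proj₁; proj₂; uncurry)
open import Data.Sum.Base as Sum using (_⊎_; inj₁; inj₂)
open import Data.Unit.Base using (tt)
open import Data.Vec.Base
  using (Vec; []; _∷_; map; zipWith; lookup; tabulate; replicate)
open import Data.Vec.Properties
  using (map-∘; map-cong; map-id; map-const; map-replicate; lookup-zipWith;
         lookup-map; lookup∘tabulate; tabulate∘lookup; tabulate-∘; tabulate-cong; lookup-replicate;
         zipWith-identityˡ; zipWith-identityʳ; zipWith-comm; []=⇒lookup; lookup⇒[]=)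
open import Data.Vec.Relation.Unary.All as All using (All; []; _∷_)
open import Function.Base using (_∘_; id)
open import Function.Bundles using (_⇔_; mk⇔; Equivalence)
open import Level using (0ℓ; suc; lift; lower)
open import Relation.Binary.PropositionalEquality
  using (_≡_; refl; sym; trans; cong; cong₂; subst; module ≡-Reasoning)
open import Relation.Nullary.Decidable
  using (Dec; yes; no; does; map′; dec-true; dec-false; decidable-stable)
open import Relation.Nullary.Negation.Core using (¬_; contradiction)
open import Relation.Unary using (_∈_; _≐_)

private
  variable
    A B C : Set
    k n : ℕ

-- Vectors and Boolean operations

_↔_ : Bool → Bool → Bool
a ↔ b = iff (a ∷ b ∷ [])

_⇒_ : Bool → Bool → Bool
a ⇒ b = if a then b else true

-- A two-variable truth table. Zipped along two bit vectors it puts one of four entries at each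
-- place, so that an operation can be probed with only four distinct arguments.
cases : A → A → A → A → Bool → Bool → A
cases a b c d true  true  = a
cases a b c d true  false = b
cases a b c d false true  = c
cases a b c d false false = d

cases-η : (φ : Bool → Bool → A) → ∀ a b →
          cases (φ true true) (φ true false) (φ false true) (φ false false) a b ≡ φ a b
cases-η φ true  true  = refl
cases-η φ true  false = refl
cases-η φ false true  = refl
cases-η φ false false = refl

map-cases : (h : A → B) {p q r s : A} → ∀ a b →
            h (cases p q r s a b) ≡ cases (h p) (h q) (h r) (h s) a b
map-cases h true  true  = refl
map-cases h true  false = refl
map-cases h false true  = refl
map-cases h false false = refl

map-zipWith : {D E : Set} {h : D → E} {φ : A → B → D} {ψ : A → B → E} →
              (∀ a b → h (φ a b) ≡ ψ a b) → (xs : Vec A n) (ys : Vec B n) →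
              map h (zipWith φ xs ys) ≡ zipWith ψ xs ys
map-zipWith eq []       []       = refl
map-zipWith eq (x ∷ xs) (y ∷ ys) = cong₂ _∷_ (eq x y) (map-zipWith eq xs ys)

zipWith-cong : {φ ψ : A → B → C} → (∀ a b → φ a b ≡ ψ a b) →
               (xs : Vec A n) (ys : Vec B n) → zipWith φ xs ys ≡ zipWith ψ xs ys
zipWith-cong eq xs ys = trans (sym (map-id _)) (map-zipWith eq xs ys)

zipWith-const : (xs : Vec A n) (ys : Vec B n) → zipWith (λ x _ → x) xs ys ≡ xs
zipWith-const []       []       = refl
zipWith-const (x ∷ xs) (y ∷ ys) = cong (x ∷_) (zipWith-const xs ys)

zipWith-flip-const : (xs : Vec A n) (ys : Vec B n) → zipWith (λ _ y → y) xs ys ≡ ys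
zipWith-flip-const []       []       = refl
zipWith-flip-const (x ∷ xs) (y ∷ ys) = cong (y ∷_) (zipWith-flip-const xs ys)

zipWith-tabulate : (φ : A → B → C) (α : Fin n → A) (β : Fin n → B) →
                   zipWith φ (tabulate α) (tabulate β) ≡ tabulate (λ i → φ (α i) (β i))
zipWith-tabulate {n = ℕ.zero}  φ α β = refl
zipWith-tabulate {n = ℕ.suc n} φ α β =
  cong (φ (α Fin.zero) (β Fin.zero) ∷_) (zipWith-tabulate φ (α ∘ Fin.suc) (β ∘ Fin.suc))

⇒-∧-absorb : (xs ys : Vec Bool n) → zipWith _∧_ (zipWith _⇒_ xs ys) ys ≡ ys
⇒-∧-absorb []           []       = refl
⇒-∧-absorb (true  ∷ xs) (y ∷ ys) = cong₂ _∷_ (∧-idem y) (⇒-∧-absorb xs ys)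
⇒-∧-absorb (false ∷ xs) (y ∷ ys) = cong (y ∷_) (⇒-∧-absorb xs ys)

all-true-or-false-at : (xs : Vec Bool n) → xs ≡ replicate n true ⊎ (∃[ i ] lookup xs i ≡ false)
all-true-or-false-at []           = inj₁ refl
all-true-or-false-at (false ∷ xs) = inj₂ (Fin.zero , refl)
all-true-or-false-at (true  ∷ xs) with all-true-or-false-at xs
... | inj₁ eq       = inj₁ (cong (true ∷_) eq)
... | inj₂ (i , eq) = inj₂ (Fin.suc i , eq)

true≢false : ∀ {b} → b ≡ true → ¬ (b ≡ false)
true≢false refl ()

by-truth : ∀ {a b} → (a ≡ true → b ≡ true) → (b ≡ true → a ≡ true) → a ≡ b
by-truth to from = ⇔→≡ (mk⇔ to from)

-- Operations commuting with a binary operation; those commuting with meets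

Preserves : (Bool → Bool → Bool) → Op k → Set
Preserves _∙_ f = ∀ xs ys → f (zipWith _∙_ xs ys) ≡ f xs ∙ f ys

IsConjunction : Op k → Vec Bool k → Set
IsConjunction f J =
  ∀ xs → f xs ≡ true ⇔ (∀ j → lookup J j ≡ true → lookup xs j ≡ true)

NotVerySignificant : Op k → Set
NotVerySignificant f = (∀ xs → f xs ≡ false) ⊎ ∃ (IsConjunction f)

-- j belongs to J iff f is false at the vector whose only false entry is the
-- j-th; every vector is a meet of such vectors.
preserves-∧⇒conjunction : (f : Op k) → Preserves _∧_ f →
                          f (replicate k true) ≡ true → ∃ (IsConjunction f)
preserves-∧⇒conjunction {ℕ.zero} f _ f1 = [] , λ where [] → mk⇔ (λ _ ()) (λ _ → f1)
preserves-∧⇒conjunction {ℕ.suc k} f f-∧ f1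
  with J , J-conj ← preserves-∧⇒conjunction (f ∘ (true ∷_))
                      (λ xs ys → f-∧ (true ∷ xs) (true ∷ ys)) f1
  = not b ∷ J , λ where (x ∷ xs) → mk⇔ (to x xs) (from x xs)
  where
  b = f (false ∷ replicate k true)

  split : ∀ x xs → f (x ∷ xs) ≡ f (x ∷ replicate k true) ∧ f (true ∷ xs)
  split x xs = trans
    (cong f (cong₂ _∷_ (sym (∧-identityʳ x)) (sym (zipWith-identityˡ ∧-identityˡ xs))))
    (f-∧ (x ∷ replicate k true) (true ∷ xs))

  to : ∀ x xs → f (x ∷ xs) ≡ true →
       ∀ j → lookup (not b ∷ J) j ≡ true → lookup (x ∷ xs) j ≡ true
  to true  xs fx Fin.zero    nb = refl
  to false xs fx Fin.zero    nb =
    contradiction (trans (sym nb) (cong not (∧-conicalˡ _ _ (trans (sym (split false xs)) fx))))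
                  λ ()
  to x     xs fx (Fin.suc j) j∈ =
    Equivalence.to (J-conj xs) (∧-conicalʳ _ _ (trans (sym (split x xs)) fx)) j j∈

  at-head : ∀ x → (not b ≡ true → x ≡ true) → f (x ∷ replicate k true) ≡ true
  at-head true  h = f1
  at-head false h with b
  ... | true  = refl
  ... | false = h refl

  from : ∀ x xs → (∀ j → lookup (not b ∷ J) j ≡ true → lookup (x ∷ xs) j ≡ true) →
         f (x ∷ xs) ≡ true
  from x xs h = trans (split x xs)
    (cong₂ _∧_ (at-head x (h Fin.zero)) (Equivalence.from (J-conj xs) (h ∘ Fin.suc)))

-- The all-true vector is the unit for pointwise `_∧_`, so a false value there spreads to every
-- vector.
preserves-∧⇒not-very-significant : (f : Op k) → Preserves _∧_ f → NotVerySignificant f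
preserves-∧⇒not-very-significant {k} f f-∧ with f (replicate k true) in f1
... | true  = inj₂ (preserves-∧⇒conjunction f f-∧ f1)
... | false = inj₁ λ xs → begin
  f xs                                    ≡⟨ cong f (zipWith-identityʳ ∧-identityʳ xs) ⟨
  f (zipWith _∧_ xs (replicate k true))   ≡⟨ f-∧ xs _ ⟩
  f xs ∧ f (replicate k true)             ≡⟨ cong (f xs ∧_) f1 ⟩
  f xs ∧ false                            ≡⟨ ∧-zeroʳ (f xs) ⟩
  false                                   ∎
  where open ≡-Reasoning

-- Bi-implication and the clone it generates

↔-medial : ∀ a b c d → (a ↔ b) ↔ (c ↔ d) ≡ (a ↔ c) ↔ (b ↔ d)
↔-medial true  true  true  true  = refl
↔-medial true  true  true  false = refl
↔-medial true  true  false true  = refl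
↔-medial true  true  false false = refl
↔-medial true  false true  true  = refl
↔-medial true  false true  false = refl
↔-medial true  false false true  = refl
↔-medial true  false false false = refl
↔-medial false true  true  true  = refl
↔-medial false true  true  false = refl
↔-medial false true  false true  = refl
↔-medial false true  false false = refl
↔-medial false false true  true  = refl
↔-medial false false true  false = refl
↔-medial false false false true  = refl
↔-medial false false false false = refl

↔-refl : ∀ a → a ↔ a ≡ true
↔-refl true  = refl
↔-refl false = refl

↔-identityˡ : ∀ a → true ↔ a ≡ a
↔-identityˡ true  = refl
↔-identityˡ false = refl

↔-identityʳ : ∀ a → a ↔ true ≡ a
↔-identityʳ true  = refl
↔-identityʳ false = refl

-- With `true` as zero, `↔` is addition in the two-element group, so it commutes with itself by
-- `↔-medial`; commuting with `↔` holds for projections and passes to compositions.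
clone⇒preserves-↔ : {f : Op (ℕ.suc n)} → Clone iff f → Preserves _↔_ f
clone⇒preserves-↔ gen (a ∷ b ∷ []) (c ∷ d ∷ []) = ↔-medial a c b d
clone⇒preserves-↔ (proj i) xs ys = lookup-zipWith _↔_ i xs ys
clone⇒preserves-↔ (comp {f = f} {g} F G) xs ys = begin
  f (tabulate (λ i → g i (zipWith _↔_ xs ys)))
    ≡⟨ cong f (tabulate-cong λ i → clone⇒preserves-↔ (G i) xs ys) ⟩
  f (tabulate (λ i → g i xs ↔ g i ys))
    ≡⟨ cong f (zipWith-tabulate _↔_ (λ i → g i xs) (λ i → g i ys)) ⟨
  f (zipWith _↔_ (tabulate (λ i → g i xs)) (tabulate (λ i → g i ys)))
    ≡⟨ clone⇒preserves-↔ F _ _ ⟩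
  f (tabulate (λ i → g i xs)) ↔ f (tabulate (λ i → g i ys)) ∎
  where open ≡-Reasoning
clone⇒preserves-↔ (ext f≗g F) xs ys = begin
  _ ≡⟨ f≗g _ ⟨
  _ ≡⟨ clone⇒preserves-↔ F xs ys ⟩
  _ ≡⟨ cong₂ _↔_ (f≗g xs) (f≗g ys) ⟩
  _ ∎
  where open ≡-Reasoning

clone-↔ : {f g : Op (ℕ.suc n)} → Clone iff f → Clone iff g → Clone iff (λ xs → f xs ↔ g xs)
clone-↔ {n = n} {f} {g} F G = comp {g = fg} gen λ where
    Fin.zero           → F
    (Fin.suc Fin.zero) → G
  where
  fg : Fin 2 → Op (ℕ.suc n)
  fg Fin.zero    = f
  fg (Fin.suc _) = g

clone-true : Clone iff {n} (λ _ → true)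
clone-true = ext (λ xs → ↔-refl (lookup xs Fin.zero)) (clone-↔ (proj Fin.zero) (proj Fin.zero))

clone-tail : {f : Op (ℕ.suc n)} → Clone iff f → Clone iff {ℕ.suc n} (λ { (x ∷ xs) → f xs })
clone-tail {f = f} F =
  ext (λ { (x ∷ xs) → cong f (tabulate∘lookup xs) }) (comp F (λ i → proj (Fin.suc i)))

preserves-↔⇒true : (f : Op k) → Preserves _↔_ f → ∀ xs → f (zipWith _↔_ xs xs) ≡ true
preserves-↔⇒true f f-↔ xs = trans (f-↔ xs xs) (↔-refl (f xs))

-- f (x ∷ xs) = f (x ∷ 1) ↔ f (1 ∷ xs), and f (x ∷ 1) is either x or 1.
preserves-↔⇒clone : (f : Op (ℕ.suc n)) → Preserves _↔_ f → Clone iff f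
preserves-↔⇒clone {n} f f-↔ = ext (λ { (x ∷ xs) → sym (split x xs) })
    (clone-↔ head-clone (tail-clone n f f-↔))
  where
  ones = replicate n true

  split : ∀ x xs → f (x ∷ xs) ≡ f (x ∷ ones) ↔ f (true ∷ xs)
  split x xs = trans
    (cong f (cong₂ _∷_ (sym (↔-identityʳ x)) (sym (zipWith-identityˡ ↔-identityˡ xs))))
    (f-↔ (x ∷ ones) (true ∷ xs))

  f1 : f (true ∷ ones) ≡ true
  f1 = trans (cong f (cong (true ∷_) (sym (zipWith-identityˡ ↔-identityˡ ones))))
             (preserves-↔⇒true f f-↔ (true ∷ ones))

  head-clone : Clone iff {n} (λ { (x ∷ xs) → f (x ∷ ones) })
  head-clone with f (false ∷ ones) in f0
  ... | true  = ext (λ { (true ∷ _) → sym f1 ; (false ∷ _) → sym f0 }) clone-true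
  ... | false = ext (λ { (true ∷ _) → sym f1 ; (false ∷ _) → sym f0 }) (proj Fin.zero)

  -- Fixing the first argument at `true` lowers the arity and keeps preservation, because
  -- `true ↔ true` is `true`; with no argument left the value is true.
  tail-clone : ∀ n (f : Op (ℕ.suc n)) → Preserves _↔_ f →
               Clone iff {n} (λ { (x ∷ xs) → f (true ∷ xs) })
  tail-clone ℕ.zero    f f-↔ =
    ext (λ { (x ∷ []) → sym (preserves-↔⇒true f f-↔ (true ∷ [])) }) clone-true
  tail-clone (ℕ.suc n) f f-↔ = ext (λ { (x ∷ y ∷ xs) → refl })
    (clone-tail (preserves-↔⇒clone (f ∘ (true ∷_))
                  (λ xs ys → f-↔ (true ∷ xs) (true ∷ ys))))

∈𝒞↔⇒preserves-↔ : ∀ c → c ∈𝒞↔ → Preserves _↔_ (interp c)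
∈𝒞↔⇒preserves-↔ (connective ℕ.zero    f) F [] [] = clone⇒preserves-↔ F (true ∷ []) (true ∷ [])
∈𝒞↔⇒preserves-↔ (connective (ℕ.suc n) f) F       = clone⇒preserves-↔ F

preserves-↔⇒∈𝒞↔ : ∀ c → Preserves _↔_ (interp c) → c ∈𝒞↔
preserves-↔⇒∈𝒞↔ (connective ℕ.zero    f) f-↔ = preserves-↔⇒clone (λ _ → f []) λ _ _ → f-↔ [] []
preserves-↔⇒∈𝒞↔ (connective (ℕ.suc n) f) f-↔ = preserves-↔⇒clone f f-↔

-- Formulas

module _ {Σ : Signature} where

  -- Primitive recursion rather than a fold: the algebra also sees the immediate subformulas, as is
  -- needed when a formula headed by `s₂` becomes an atom or gets a value that depends on its
  -- syntax.
  module Para {A : Set} (env : ℕ → A)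
              (alg : ∀ s → Vec (Form Σ) (arity Σ s) → Vec A (arity Σ s) → A) where

    para  : Form Σ → A
    para* : Vec (Form Σ) n → Vec A n

    para (var i)   = env i
    para (op s As) = alg s As (para* As)

    para* []       = []
    para* (A ∷ As) = para A ∷ para* As

    para*≡map : (As : Vec (Form Σ) n) → para* As ≡ map para As
    para*≡map []       = refl
    para*≡map (A ∷ As) = cong (para A ∷_) (para*≡map As)

  module _ (P : Form Σ → Set) (P-var : ∀ i → P (var i))
           (P-op : ∀ s {As} → All P As → P (op s As)) where

    Form-ind  : ∀ A → P A
    Form-ind* : (As : Vec (Form Σ) n) → All P As

    Form-ind (var i)   = P-var i
    Form-ind (op s As) = P-op s (Form-ind* As)

    Form-ind* []       = []
    Form-ind* (A ∷ As) = Form-ind A ∷ Form-ind* As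

  []*≡map : (σ : ℕ → Form Σ) (As : Vec (Form Σ) n) → As [ σ ]* ≡ map (_[ σ ]) As
  []*≡map σ []       = refl
  []*≡map σ (A ∷ As) = cong (A [ σ ] ∷_) ([]*≡map σ As)

inˡ*≡map : ∀ {Σa Σb} (As : Vec (Form Σa) n) → inˡ* {Σb = Σb} As ≡ map inˡ As
inˡ*≡map []       = refl
inˡ*≡map (A ∷ As) = cong (inˡ A ∷_) (inˡ*≡map As)

inʳ*≡map : ∀ {Σa Σb} (As : Vec (Form Σb) n) → inʳ* {Σa = Σa} As ≡ map inʳ As
inʳ*≡map []       = refl
inʳ*≡map (A ∷ As) = cong (inʳ A ∷_) (inʳ*≡map As)

-- 2ᵃ (2 b + 1)
pair : ℕ → ℕ → ℕ
pair ℕ.zero    b = ℕ.suc (2 * b)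
pair (ℕ.suc a) b = 2 * pair a b

pair-injective : ∀ a b c d → pair a b ≡ pair c d → a ≡ c × b ≡ d
pair-injective ℕ.zero    b ℕ.zero    d eq = refl , *-cancelˡ-≡ b d 2 (suc-injective eq)
pair-injective ℕ.zero    b (ℕ.suc c) d eq = contradiction (sym eq) (even≢odd (pair c d) b)
pair-injective (ℕ.suc a) b ℕ.zero    d eq = contradiction eq (even≢odd (pair a b) d)
pair-injective (ℕ.suc a) b (ℕ.suc c) d eq =
  let a≡c , b≡d = pair-injective a b c d (*-cancelˡ-≡ _ _ 2 eq) in cong ℕ.suc a≡c , b≡d

module Coding {Σ : Signature} (index : Symbol Σ → ℕ)
              (index-injective : ∀ {s t} → index s ≡ index t → s ≡ t) where

  -- Lengths are not recorded, since the head symbol fixes them.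
  code-vec : Vec ℕ n → ℕ
  code-vec []       = 0
  code-vec (m ∷ ms) = pair m (code-vec ms)

  -- Tag 0 is reserved for variables, hence the shift of the symbol indices.
  open Para {Σ} (pair 0) (λ s _ ms → pair (ℕ.suc (index s)) (code-vec ms))
    renaming (para to code; para* to code*) using () public

  code-injective  : ∀ A B → code A ≡ code B → A ≡ B
  code*-injective : (As Bs : Vec (Form Σ) n) →
                    code-vec (code* As) ≡ code-vec (code* Bs) → As ≡ Bs

  code-injective (var i)   (var j)   eq = cong var (proj₂ (pair-injective 0 i 0 j eq))
  code-injective (var i)   (op t Bs) eq =
    contradiction (proj₁ (pair-injective 0 i (ℕ.suc (index t)) (code-vec (code* Bs)) eq)) λ ()
  code-injective (op s As) (var j)   eq =
    contradiction (proj₁ (pair-injective (ℕ.suc (index s)) (code-vec (code* As)) 0 j eq)) λ ()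
  code-injective (op s As) (op t Bs) eq
    with pair-injective (ℕ.suc (index s)) (code-vec (code* As))
                        (ℕ.suc (index t)) (code-vec (code* Bs)) eq
  ... | eq₁ , eq₂ with index-injective (suc-injective eq₁)
  ... | refl = cong (op s) (code*-injective As Bs eq₂)

  code*-injective []       []       eq = refl
  code*-injective (A ∷ As) (B ∷ Bs) eq
    with pair-injective (code A) (code-vec (code* As)) (code B) (code-vec (code* Bs)) eq
  ... | eq₁ , eq₂ = cong₂ _∷_ (code-injective A B eq₁) (code*-injective As Bs eq₂)

-- Valuations respecting one connective only

module _ (K : Connectives) where

  private
    F = Form (signature K)

  Respects : Symbol (signature K) → (F → Bool) → Set
  Respects s v = ∀ As → v (op s As) ≡ ⟦ K ⟧ s (map v As)

infix 4 _≼_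
_≼_ : (A → Bool) → (A → Bool) → Set
χ ≼ v = ∀ A → χ A ≡ true → v A ≡ true

-- χ is a pointwise meet of functions in V.
Closed : ((A → Bool) → Set) → (A → Bool) → Set
Closed V χ = ∀ {D} → χ D ≡ false → ∃[ v ] (V v × χ ≼ v × v D ≡ false)

module _ (K : Connectives) (s₁ s₂ : Symbol (signature K)) where

  RespectsBoth : (Form (signature K) → Bool) → Set
  RespectsBoth v = Respects K s₁ v × Respects K s₂ v

  MeetComplete : Set
  MeetComplete = ∀ χ → Closed (Respects K s₁) χ → Closed (Respects K s₂) χ →
                 Closed RespectsBoth χ

-- S consists of the two distinct elements s₁ and s₂.
record Splits {S : Set} (s₁ s₂ : S) : Set₁ where
  field
    elim  : (P : S → Set) → P s₁ → P s₂ → ∀ s → P s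
    elim₁ : ∀ P {p q} → elim P p q s₁ ≡ p
    elim₂ : ∀ P {p q} → elim P p q s₂ ≡ q

∪ᶜ-splits : ∀ {c₁ c₂} → Splits {Symbol (signature (⟨ c₁ ⟩ ∪ᶜ ⟨ c₂ ⟩))} (inj₁ tt) (inj₂ tt)
∪ᶜ-splits = record
  { elim  = λ { _ p q (inj₁ tt) → p ; _ p q (inj₂ tt) → q }
  ; elim₁ = λ _ → refl
  ; elim₂ = λ _ → refl
  }

-- The later arguments treat the two symbols asymmetrically; this makes each of them available with
-- the roles exchanged.
splits-sym : {S : Set} {s₁ s₂ : S} → Splits s₁ s₂ → Splits s₂ s₁
splits-sym sp = record
  { elim = λ P p q → elim P q p ; elim₁ = λ P → elim₂ P ; elim₂ = λ P → elim₁ P }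
  where open Splits sp

-- From consequence relations to meets of valuations

module Classical (em : ExcludedMiddle (suc 0ℓ)) where

  -- Derivability in the fibring lives one level higher, which is why `em` is assumed there;
  -- elsewhere this form is enough.
  em₀ : {P : Set} → Dec P
  em₀ = map′ lower lift em

  closed-intro : (V : (A → Bool) → Set) (χ : A → Bool) →
                 (∀ D → (∀ v → V v → χ ≼ v → v D ≡ true) → χ D ≡ true) → Closed V χ
  closed-intro V χ h {D} χD with em₀ {∃[ v ] (V v × χ ≼ v × v D ≡ false)}
  ... | yes found = found
  ... | no  none  = contradiction χD (true≢false (h D λ v Vv χ≼v →
    ¬-not λ vD → none (v , Vv , χ≼v , vD)))

  retraction : (f : A → ℕ) → (∀ x y → f x ≡ f y → x ≡ y) → A → ∃[ g ] (∀ x → g (f x) ≡ x)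
  retraction {A} f f-inj a₀ = g , g∘f
    where
    g : ℕ → A
    g m with em₀ {∃[ x ] f x ≡ m}
    ... | yes (x , _) = x
    ... | no  _       = a₀

    g∘f : ∀ x → g (f x) ≡ x
    g∘f x with em₀ {∃[ y ] f y ≡ f x}
    ... | yes (y , eq) = f-inj y x eq
    ... | no  none     = contradiction (x , refl) none

  -- Formulas headed by s₂ are coded as variables of the language of s₁, so
  -- that an entailment valid for all valuations respecting s₁ becomes a
  -- substitution instance of an entailment between pure formulas.
  module Skeleton (K : Connectives) {s₁ s₂ : Symbol (signature K)} (splits : Splits s₁ s₂) where

    open Splits splits

    private
      Σ = signature K
      c = connective (arity Σ s₁) (⟦ K ⟧ s₁)
      L = Form (signature ⟨ c ⟩)

    index : Symbol Σ → ℕ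
    index = elim (λ _ → ℕ) 0 1

    index₁≢index₂ : ¬ (index s₁ ≡ index s₂)
    index₁≢index₂ eq with () ← trans (sym (elim₁ (λ _ → ℕ))) (trans eq (elim₂ (λ _ → ℕ)))

    index-injective : ∀ {s t} → index s ≡ index t → s ≡ t
    index-injective {s} {t} = elim (λ s → index s ≡ index t → s ≡ t)
      (elim (λ t → index s₁ ≡ index t → s₁ ≡ t)
        (λ _ → refl) (λ eq → contradiction eq index₁≢index₂) t)
      (elim (λ t → index s₂ ≡ index t → s₂ ≡ t)
        (λ eq → contradiction (sym eq) index₁≢index₂) (λ _ → refl) t) s

    open Coding {Σ} index index-injective using (code; code-injective)

    private
      Alg : Symbol Σ → Set
      Alg s = Vec (Form Σ) (arity Σ s) → Vec L (arity Σ s) → L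

      keep : Alg s₁
      keep _ = op tt

      abstr : Alg s₂
      abstr As _ = var (code (op s₂ As))

    open Para {Σ} {L} (λ i → var (code (var i)))
      (elim Alg keep abstr)
      renaming (para to skeleton; para*≡map to skeleton*≡map; para* to skeleton*)

    skeleton-op₁ : ∀ As → skeleton (op s₁ As) ≡ op tt (map skeleton As)
    skeleton-op₁ As =
      trans (cong (λ a → a As (skeleton* As)) (elim₁ Alg)) (cong (op tt) (skeleton*≡map As))

    skeleton-op₂ : ∀ As → skeleton (op s₂ As) ≡ var (code (op s₂ As))
    skeleton-op₂ As = cong (λ a → a As (skeleton* As)) (elim₂ Alg)

    -- Since `skeleton` commutes with `s₁`, pure valuations pull back; formulas headed by `s₂` have
    -- become variables and impose no condition.
    skeleton-respects : (v : Valuation ⟨ c ⟩) → Respects K s₁ (val v ∘ skeleton)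
    skeleton-respects v As = begin
      val v (skeleton (op s₁ As))             ≡⟨ cong (val v) (skeleton-op₁ As) ⟩
      val v (op tt (map skeleton As))         ≡⟨ val-op v tt _ ⟩
      interp c (map (val v) (map skeleton As)) ≡⟨ cong (interp c) (map-∘ (val v) skeleton As) ⟨
      interp c (map (val v ∘ skeleton) As)    ∎
      where open ≡-Reasoning

    module _ (incl : L → Form Σ) (incl-var : ∀ i → incl (var i) ≡ var i)
             (incl-op : ∀ As → incl (op tt As) ≡ op s₁ (map incl As)) where

      decode : ℕ → Form Σ
      decode = proj₁ (retraction code code-injective (var 0))

      decode-code : ∀ A → decode (code A) ≡ A
      decode-code = proj₂ (retraction code code-injective (var 0))

      unfold : L → Form Σ
      unfold A = incl A [ decode ]

      unfold-code : ∀ A → unfold (var (code A)) ≡ A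
      unfold-code A = trans (cong (_[ decode ]) (incl-var _)) (decode-code A)

      map-id-All : {g : Form Σ → Form Σ} {As : Vec (Form Σ) n} →
                   All (λ A → g A ≡ A) As → map g As ≡ As
      map-id-All []         = refl
      map-id-All (eq ∷ eqs) = cong₂ _∷_ eq (map-id-All eqs)

      -- Substituting for each variable the formula it codes undoes the abstraction. A formula
      -- headed by `s₂` is restored in one piece, without induction hypotheses.
      unfold-skeleton : ∀ A → unfold (skeleton A) ≡ A
      unfold-skeleton = Form-ind _ (λ i → unfold-code (var i))
        (elim (λ s → ∀ {As} → All (λ A → unfold (skeleton A) ≡ A) As →
                     unfold (skeleton (op s As)) ≡ op s As)
          (λ {As} eqs → begin
            unfold (skeleton (op s₁ As))        ≡⟨ cong unfold (skeleton-op₁ As) ⟩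
            unfold (op tt (map skeleton As))    ≡⟨ cong (_[ decode ]) (incl-op _) ⟩
            op s₁ (map incl (map skeleton As) [ decode ]*) ≡⟨ cong (op s₁) ([]*≡map decode _) ⟩
            op s₁ (map (_[ decode ]) (map incl (map skeleton As)))
              ≡⟨ cong (op s₁) (trans (map-∘ unfold skeleton As) (map-∘ (_[ decode ]) incl _)) ⟨
            op s₁ (map (unfold ∘ skeleton) As)  ≡⟨ cong (op s₁) (map-id-All eqs) ⟩
            op s₁ As                            ∎)
          (λ {As} _ → trans (cong unfold (skeleton-op₂ As)) (unfold-code (op s₂ As))))
        where open ≡-Reasoning

      entails : ∀ {ℓ} {_⊩_ : Consequence Σ ℓ} → IsConsequence _⊩_ →
                (∀ {Γ C} → 𝓑 ⟨ c ⟩ ∶ Γ ⊢ C → image incl Γ ⊩ incl C) →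
                ∀ {Γ C} → (∀ v → Respects K s₁ v → (∀ {G} → G ∈ Γ → v G ≡ true) → v C ≡ true) →
                Γ ⊩ C
      entails {_⊩_ = _⊩_} ⊩-isConsequence ⊩-incl {Γ} {C} Γ⊨C =
        subst (Γ ⊩_) (unfold-skeleton C)
          (⊩.resp Γ≐ (⊩.SI decode (⊩-incl {image skeleton Γ} λ v v⊨ →
            Γ⊨C (val v ∘ skeleton) (skeleton-respects v) λ G∈Γ → v⊨ (_ , G∈Γ , refl))))
        where
        module ⊩ = IsConsequence ⊩-isConsequence

        Γ≐ : image (_[ decode ]) (image incl (image skeleton Γ)) ≐ Γ
        Γ≐ = (λ { (_ , (_ , (G , G∈Γ , refl) , refl) , refl) →
                  subst Γ (sym (unfold-skeleton G)) G∈Γ })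
           , λ {G} G∈Γ → _ , (_ , (G , G∈Γ , refl) , refl) , sym (unfold-skeleton G)

  -- Theories of the fibring are the subsets closed under both logics.
  module Criterion (c₁ c₂ : Connective) where

    private
      K = ⟨ c₁ ⟩ ∪ᶜ ⟨ c₂ ⟩
      Σ = signature K
      𝓕 = 𝓑 ⟨ c₁ ⟩ • 𝓑 ⟨ c₂ ⟩
      V₁ = Respects K (inj₁ tt)
      V₂ = Respects K (inj₂ tt)
      V₁₂ = RespectsBoth K (inj₁ tt) (inj₂ tt)

    to-valuation : ∀ {v} → V₁₂ v → Valuation K
    to-valuation {v} (v₁ , v₂) = record
      { val = v ; val-op = λ { (inj₁ tt) → v₁ ; (inj₂ tt) → v₂ } }

    -- Precomposing a valuation with a substitution keeps it respectful; this is what makes `_⊩_`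
    -- closed under `SI`.
    Closed-[] : ∀ {s χ} (σ : ℕ → Form Σ) →
                Closed (Respects K s) χ → Closed (Respects K s) (χ ∘ _[ σ ])
    Closed-[] {s} σ χ-closed χD with χ-closed χD
    ... | v , v-resp , χ≼v , vD = v ∘ _[ σ ] , resp-σ , (λ A → χ≼v (A [ σ ])) , vD
      where
      resp-σ : Respects K s (v ∘ _[ σ ])
      resp-σ As = trans (v-resp (As [ σ ]*)) (cong (⟦ K ⟧ s)
        (trans (cong (map v) ([]*≡map σ As)) (sym (map-∘ v (_[ σ ]) As))))

    -- Consequence over the theories common to both logics; by minimality it contains the fibring.
    _⊩_ : Consequence Σ 0ℓ
    Γ ⊩ C = ∀ χ → Closed V₁ χ → Closed V₂ χ → (∀ {G} → G ∈ Γ → χ G ≡ true) → χ C ≡ true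

    ⊩-isConsequence : IsConsequence _⊩_
    ⊩-isConsequence = record
      { resp = λ Γ≐Δ Γ⊩C χ χ₁ χ₂ χΔ → Γ⊩C χ χ₁ χ₂ (χΔ ∘ proj₁ Γ≐Δ)
      ; R    = λ χ χ₁ χ₂ χΓ → χΓ (inj₂ refl)
      ; M    = λ Γ⊩C χ χ₁ χ₂ χΓ → Γ⊩C χ χ₁ χ₂ (χΓ ∘ inj₁)
      ; T    = λ Γ⊩Δ Γ∪Δ⊩C χ χ₁ χ₂ χΓ → Γ∪Δ⊩C χ χ₁ χ₂
                 Sum.[ χΓ , (λ D∈Δ → Γ⊩Δ D∈Δ χ χ₁ χ₂ χΓ) ]
      ; SI   = λ σ Γ⊩C χ χ₁ χ₂ χΓ → Γ⊩C (χ ∘ _[ σ ]) (Closed-[] σ χ₁) (Closed-[] σ χ₂)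
                 λ G∈Γ → χΓ (_ , G∈Γ , refl)
      }

    -- If `χ` refuted the conclusion, a single respecting valuation above `χ` would refute it too,
    -- and its restriction to the pure language would contradict the entailment.
    closed-entails : ∀ {c} {incl : Form (signature ⟨ c ⟩) → Form Σ} {s} →
                     (∀ {v} → Respects K s v →
                       ∃[ w ] (∀ A → val {⟨ c ⟩} w A ≡ v (incl A))) →
                     ∀ {Γ C χ} → 𝓑 ⟨ c ⟩ ∶ Γ ⊢ C → Closed (Respects K s) χ →
                     (∀ {G} → G ∈ image incl Γ → χ G ≡ true) → χ (incl C) ≡ true
    closed-entails restrict {C = C} {χ} Γ⊢C χ-closed χΓ =
      ¬-not λ χC → let v , v-resp , χ≼v , vC = χ-closed χC
                       w , w≡v = restrict v-resp
                   in true≢false (Γ⊢C w λ G∈Γ → trans (w≡v _) (χ≼v _ (χΓ (_ , G∈Γ , refl))))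
                        (trans (w≡v C) vC)

    restrictˡ : ∀ {v} → V₁ v → ∃[ w ] (∀ A → val {⟨ c₁ ⟩} w A ≡ v (inˡ A))
    restrictˡ {v} v₁ = record
      { val = v ∘ inˡ
      ; val-op = λ _ As → trans (v₁ (inˡ* As)) (cong (interp c₁)
          (trans (cong (map v) (inˡ*≡map As)) (sym (map-∘ v inˡ As)))) } , λ _ → refl

    restrictʳ : ∀ {v} → V₂ v → ∃[ w ] (∀ A → val {⟨ c₂ ⟩} w A ≡ v (inʳ A))
    restrictʳ {v} v₂ = record
      { val = v ∘ inʳ
      ; val-op = λ _ As → trans (v₂ (inʳ* As)) (cong (interp c₂)
          (trans (cong (map v) (inʳ*≡map As)) (sym (map-∘ v inʳ As)))) } , λ _ → refl

    𝓕⇒⊩ : ∀ {Γ C} → 𝓕 ∶ Γ ⊢ C → Γ ⊩ C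
    𝓕⇒⊩ = •-least _ _ ⊩-isConsequence
      (λ Γ⊢C χ χ₁ χ₂ → closed-entails restrictˡ Γ⊢C χ₁)
      (λ Γ⊢C χ χ₁ χ₂ → closed-entails restrictʳ Γ⊢C χ₂)

    valuation-closed : ∀ {s} {v : Form Σ → Bool} → Respects K s v → Closed (Respects K s) v
    valuation-closed v-resp vD = _ , v-resp , (λ _ → id) , vD

    sound : ∀ {Γ C} → 𝓕 ∶ Γ ⊢ C → 𝓑 K ∶ Γ ⊢ C
    sound d v = 𝓕⇒⊩ d (val v) (valuation-closed (val-op v (inj₁ tt)))
                              (valuation-closed (val-op v (inj₂ tt)))

    entailsˡ : ∀ {Γ C} → (∀ v → V₁ v → (∀ {G} → G ∈ Γ → v G ≡ true) → v C ≡ true) → 𝓕 ∶ Γ ⊢ C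
    entailsˡ = Skeleton.entails K (∪ᶜ-splits {c₁} {c₂}) inˡ (λ _ → refl)
      (λ As → cong (op (inj₁ tt)) (inˡ*≡map As)) (Logic.isConsequence 𝓕) inclˡ

    entailsʳ : ∀ {Γ C} → (∀ v → V₂ v → (∀ {G} → G ∈ Γ → v G ≡ true) → v C ≡ true) → 𝓕 ∶ Γ ⊢ C
    entailsʳ = Skeleton.entails K (splits-sym (∪ᶜ-splits {c₁} {c₂})) inʳ (λ _ → refl)
      (λ As → cong (op (inj₂ tt)) (inʳ*≡map As)) (Logic.isConsequence 𝓕) inclʳ

    -- A formula true in all joint valuations above `χ` is a two-valued consequence of the set `χ`,
    -- hence derivable from it in the fibring, hence in `χ`.
    ≋⇒meet-complete : 𝓕 ≋ 𝓑 K → MeetComplete K (inj₁ tt) (inj₂ tt)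
    ≋⇒meet-complete 𝓕≋𝓑 χ χ₁ χ₂ = closed-intro V₁₂ χ λ D D-true →
      𝓕⇒⊩ (Equivalence.from (𝓕≋𝓑 (λ G → χ G ≡ true) D)
            λ v v⊨ → D-true (val v) (val-op v (inj₁ tt) , val-op v (inj₂ tt)) λ _ → v⊨)
          χ χ₁ χ₂ id

    -- If `C` is not derivable from `Γ`, the deductive closure of `Γ` is a meet for each connective
    -- separately, so completeness yields a joint valuation separating `Γ` from `C`.
    meet-complete⇒≋ : MeetComplete K (inj₁ tt) (inj₂ tt) → 𝓕 ≋ 𝓑 K
    meet-complete⇒≋ complete Γ C = mk⇔ sound λ Γ⊨C → decidable-stable em λ ¬Γ⊢C →
      let v , v₁₂ , χ≼v , vC = complete χ (χ-closed entailsˡ) (χ-closed entailsʳ)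
                                 (dec-false em ¬Γ⊢C)
      in true≢false (Γ⊨C (to-valuation v₁₂) λ G∈Γ → χ≼v _ (dec-true em (assumption G∈Γ))) vC
      where
      χ : Form Σ → Bool
      χ A = does (em {𝓕 ∶ Γ ⊢ A})

      χ-sound : ∀ {A} → χ A ≡ true → 𝓕 ∶ Γ ⊢ A
      χ-sound {A} χA with em {𝓕 ∶ Γ ⊢ A}
      ... | yes d = d

      assumption : ∀ {A} → A ∈ Γ → 𝓕 ∶ Γ ⊢ A
      assumption A∈Γ = resp (Sum.[ id , (λ { refl → A∈Γ }) ] , inj₁) R

      -- A formula true in every member of `V` above `χ` is derivable from the theory `χ`, and `T`
      -- brings the derivation back to `Γ`.
      χ-closed : {V : (Form Σ → Bool) → Set} →
                 (∀ {Δ A} → (∀ v → V v → (∀ {G} → G ∈ Δ → v G ≡ true) → v A ≡ true) → 𝓕 ∶ Δ ⊢ A) →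
                 Closed V χ
      χ-closed {V} V-entails = closed-intro V χ λ D D-true → dec-true em
        (T {Δ = λ A → χ A ≡ true} χ-sound (resp
          (inj₂ , Sum.[ (λ A∈Γ → dec-true em (assumption A∈Γ)) , id ])
          (V-entails {λ A → χ A ≡ true} λ v Vv v⊨ → D-true v Vv λ _ → v⊨)))

-- Sufficiency

zipWith-map-map : {D : Set} (φ : B → C → D) (a : A → B) (b : A → C) (xs : Vec A n) →
                  zipWith φ (map a xs) (map b xs) ≡ map (λ x → φ (a x) (b x)) xs
zipWith-map-map φ a b []       = refl
zipWith-map-map φ a b (x ∷ xs) = cong (φ (a x) (b x) ∷_) (zipWith-map-map φ a b xs)

Vec-0-unique : k ≡ 0 → (xs ys : Vec A k) → xs ≡ ys
Vec-0-unique refl [] [] = refl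

meet-complete-sym : ∀ K {s₁ s₂} → MeetComplete K s₁ s₂ → MeetComplete K s₂ s₁
meet-complete-sym K complete χ χ₂ χ₁ χD =
  let v , (v₁ , v₂) , χ≼v , vD = complete χ χ₁ χ₂ χD in v , (v₂ , v₁) , χ≼v , vD

module _ (K : Connectives) where

  -- Conjunctions of selected arguments commute with all meets, even the empty one. For a constant
  -- false connective the meet must be nonempty, which the excluded formula `D` ensures.
  closed-respects : ∀ {s χ D} → NotVerySignificant (⟦ K ⟧ s) → Closed (Respects K s) χ →
                    χ D ≡ false → Respects K s χ
  closed-respects (inj₁ f-false) χ-closed χD As with χ-closed χD
  ... | v , v-resp , χ≼v , _ = trans
    (¬-not λ χop → true≢false (χ≼v _ χop) (trans (v-resp As) (f-false _))) (sym (f-false _))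
  closed-respects {s} {χ} (inj₂ (J , conj)) χ-closed _ As = by-truth to from
    where
    to : χ (op s As) ≡ true → ⟦ K ⟧ s (map χ As) ≡ true
    to χop = Equivalence.from (conj _) λ j j∈J → trans (lookup-map j χ As) (¬-not λ χAⱼ →
      let v , v-resp , χ≼v , vAⱼ = χ-closed χAⱼ
          vop = trans (sym (v-resp As)) (χ≼v _ χop)
      in true≢false (trans (sym (lookup-map j v As)) (Equivalence.to (conj _) vop j j∈J)) vAⱼ)

    from : ⟦ K ⟧ s (map χ As) ≡ true → χ (op s As) ≡ true
    from fχ = ¬-not λ χop →
      let v , v-resp , χ≼v , vop = χ-closed χop
          χAⱼ j j∈J = trans (sym (lookup-map j χ As)) (Equivalence.to (conj _) fχ j j∈J)
      in true≢false
           (trans (v-resp As) (Equivalence.from (conj _) λ j j∈J →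
             trans (lookup-map j v As) (χ≼v _ (χAⱼ j j∈J))))
           vop

  module _ {s₁ s₂ : Symbol (signature K)} where

    private
      f = ⟦ K ⟧ s₁
      g = ⟦ K ⟧ s₂

    constant-true⇒meet-complete : (∀ xs → g xs ≡ true) → MeetComplete K s₁ s₂
    constant-true⇒meet-complete g-true χ χ₁ χ₂ χD =
      let v , v₁ , χ≼v , vD = χ₁ χD
          v₂ As = trans (χ≼v _ (¬-not λ χop →
            let w , w₂ , _ , wop = χ₂ χop
            in true≢false (trans (w₂ As) (g-true _)) wop)) (sym (g-true _))
      in v , (v₁ , v₂) , χ≼v , vD

    not-very-significant⇒meet-complete :
      NotVerySignificant f → NotVerySignificant g → MeetComplete K s₁ s₂
    not-very-significant⇒meet-complete f-nvs g-nvs χ χ₁ χ₂ χD =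
      χ , (closed-respects f-nvs χ₁ χD , closed-respects g-nvs χ₂ χD) , (λ _ → id) , χD

    -- All formulas headed by a nullary `s₂` coincide, so a single false value settles them.
    nullary-respects : ∀ {v As} → arity (signature K) s₂ ≡ 0 → (∀ xs → g xs ≡ false) →
                       v (op s₂ As) ≡ false → Respects K s₂ v
    nullary-respects {v} nullary g-false v⊥ Bs =
      trans (cong (v ∘ op s₂) (Vec-0-unique nullary Bs _)) (trans v⊥ (sym (g-false _)))

    -- If u excludes D but not ⊥ and w excludes ⊥ but not D, then u ↔ w
    -- excludes both.
    ↔-⊥⇒meet-complete : Preserves _↔_ f → arity (signature K) s₂ ≡ 0 →
                        (∀ xs → g xs ≡ false) → MeetComplete K s₁ s₂
    ↔-⊥⇒meet-complete f-↔ nullary g-false χ χ₁ χ₂ {D} χD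
      -- `w₀` shows that `χ` refutes ⊥, so `χ₁` provides a `w` refuting ⊥; `var 0` only fills a
      -- vector of length zero.
      with w₀ , w₀₂ , χ≼w₀ , _ ← χ₂ χD
      with u , u₁ , χ≼u , uD ← χ₁ χD
      with w , w₁ , χ≼w , w⊥ ← χ₁ {op s₂ (replicate _ (var 0))}
             (¬-not λ χ⊥ → true≢false (χ≼w₀ _ χ⊥) (trans (w₀₂ _) (g-false _)))
      with u (op s₂ (replicate _ (var 0))) in u⊥ | w D in wD
    ... | false | _     = u , (u₁ , nullary-respects nullary g-false u⊥) , χ≼u , uD
    ... | true  | false = w , (w₁ , nullary-respects nullary g-false w⊥) , χ≼w , wD
    ... | true  | true  =
        v , (v₁ , nullary-respects nullary g-false (cong₂ _↔_ u⊥ w⊥))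
          , (λ A χA → cong₂ _↔_ (χ≼u A χA) (χ≼w A χA)) , cong₂ _↔_ uD wD
      where
      v : Form (signature K) → Bool
      v A = u A ↔ w A

      v₁ : Respects K s₁ v
      v₁ As = begin
        u (op s₁ As) ↔ w (op s₁ As)           ≡⟨ cong₂ _↔_ (u₁ As) (w₁ As) ⟩
        f (map u As) ↔ f (map w As)           ≡⟨ f-↔ _ _ ⟨
        f (zipWith _↔_ (map u As) (map w As)) ≡⟨ cong f (zipWith-map-map _↔_ u w As) ⟩
        f (map v As)                          ∎
        where open ≡-Reasoning

-- Necessity

module Necessity (K : Connectives) {s₁ s₂ : Symbol (signature K)} (splits : Splits s₁ s₂)
                 (complete : MeetComplete K s₁ s₂) where

  open Splits splits

  private
    Σ = signature K
    F = Form Σ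
    f = ⟦ K ⟧ s₁
    g = ⟦ K ⟧ s₂
    V = RespectsBoth K s₁ s₂

  meet : Bool × Bool → Bool
  meet = uncurry _∧_

  pattern₄ : (xs ys : Vec Bool (arity Σ s₁)) → F → F → F → F → F
  pattern₄ xs ys A B C D = op s₁ (zipWith (cases A B C D) xs ys)

  val-pattern₄ : ∀ {v xs ys A B C D a b c d} → Respects K s₁ v →
                 v A ≡ a → v B ≡ b → v C ≡ c → v D ≡ d →
                 v (pattern₄ xs ys A B C D) ≡ f (zipWith (cases a b c d) xs ys)
  val-pattern₄ {v} {xs} {ys} v₁ refl refl refl refl =
    trans (v₁ _) (cong f (map-zipWith (map-cases v) xs ys))

  -- A pair of valuations u, w respecting s₁ whose meet respects s₂: when
  -- the value of s₂ is false, choice says how u and w share the falsity.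
  module Pair (env : ℕ → Bool × Bool) (choice : Vec F (arity Σ s₂) → Bool × Bool)
              (choice-false : ∀ As → meet (choice As) ≡ false) where

    private
      Alg : Symbol Σ → Set
      Alg s = Vec F (arity Σ s) → Vec (Bool × Bool) (arity Σ s) → Bool × Bool

      componentwise : Alg s₁
      componentwise _ hs = f (map proj₁ hs) , f (map proj₂ hs)

      chosen : Alg s₂
      chosen As hs = if g (map meet hs) then (true , true) else choice As

    open Para {Σ} env (elim Alg componentwise chosen)
      renaming (para to h; para* to h*; para*≡map to h*≡map) public

    u w χ : F → Bool
    u = proj₁ ∘ h
    w = proj₂ ∘ h
    χ = meet ∘ h

    map-h* : {B : Set} (π : Bool × Bool → B) (As : Vec F n) → map π (h* As) ≡ map (π ∘ h) As
    map-h* π As = trans (cong (map π) (h*≡map As)) (sym (map-∘ π h As))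

    h-op₂ : ∀ As → h (op s₂ As) ≡ (if g (map χ As) then (true , true) else choice As)
    h-op₂ As = trans (cong (λ a → a As (h* As)) (elim₂ Alg))
      (cong (λ bs → if g bs then (true , true) else choice As) (map-h* meet As))

    u₁ : Respects K s₁ u
    u₁ As = trans (cong (λ a → proj₁ (a As (h* As))) (elim₁ Alg)) (cong f (map-h* proj₁ As))

    w₁ : Respects K s₁ w
    w₁ As = trans (cong (λ a → proj₂ (a As (h* As))) (elim₁ Alg)) (cong f (map-h* proj₂ As))

    χ₂ : Respects K s₂ χ
    χ₂ As = trans (cong meet (h-op₂ As)) (meet-if (g (map χ As)))
      where
      meet-if : ∀ b → meet (if b then (true , true) else choice As) ≡ b
      meet-if true  = refl
      meet-if false = choice-false As

    χ-closed₁ : Closed (Respects K s₁) χ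
    χ-closed₁ {D} χD with u D in uD
    ... | false = u , u₁ , (λ _ → ∧-conicalˡ _ _) , uD
    -- Here `u D` is true, so `χ D` reduces to `w D`.
    ... | true  = w , w₁ , (λ _ → ∧-conicalʳ _ _) , χD

    -- The one appeal to completeness: `χ` is the meet of `u` and `w` on the side of `s₁` and
    -- respects `s₂` itself.
    excluding : ∀ {D} → χ D ≡ false → ∃[ v ] (V v × χ ≼ v × v D ≡ false)
    excluding = complete χ χ-closed₁ (λ χD → χ , χ₂ , (λ _ → id) , χD)

    χ-valid : ∀ {E} → (∀ v → V v → χ ≼ v → v E ≡ true) → χ E ≡ true
    χ-valid E-valid = ¬-not λ χE →
      let v , v₁₂ , χ≼v , vE = excluding χE in true≢false (E-valid v v₁₂ χ≼v) vE

    χ-cong : ∀ E E′ → (∀ v → V v → χ ≼ v → v E ≡ v E′) → χ E ≡ χ E′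
    χ-cong E E′ E≡E′ = by-truth (half E≡E′) (half λ v v₁₂ χ≼v → sym (E≡E′ v v₁₂ χ≼v))
      where
      half : ∀ {E E′} → (∀ v → V v → χ ≼ v → v E ≡ v E′) → χ E ≡ true → χ E′ ≡ true
      half {E} E≡E′ χE =
        χ-valid λ v v₁₂ χ≼v → trans (sym (E≡E′ v v₁₂ χ≼v)) (χ≼v E χE)

    -- The formulas D₁₀, D₀₁ and D₀₀ get different values from (u , w) but
    -- cannot be told apart by joint valuations.
    confusion⇒preserves-∧ : ∀ {t D₁₀ D₀₁ D₀₀} → h t ≡ (true , true) →
      h D₁₀ ≡ (true , false) → h D₀₁ ≡ (false , true) → h D₀₀ ≡ (false , false) →
      (∀ v → V v → χ ≼ v → v D₁₀ ≡ v D₀₀ × v D₀₁ ≡ v D₀₀) → Preserves _∧_ f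
    confusion⇒preserves-∧ {t} {D₁₀} {D₀₁} {D₀₀} ht h₁₀ h₀₁ h₀₀ confused xs ys = begin
      -- The collapsed pattern takes the value of `f` at the meet in both `u` and `w`; the original
      -- one takes `f xs` in `u` and `f ys` in `w`. `χ-cong` equates the two.
      f (zipWith _∧_ xs ys)       ≡⟨ ∧-idem _ ⟨
      f (zipWith _∧_ xs ys) ∧ f (zipWith _∧_ xs ys)
        ≡⟨ cong₂ _∧_ (collapsed u₁ (cong proj₁ ht) (cong proj₁ h₀₀))
                     (collapsed w₁ (cong proj₂ ht) (cong proj₂ h₀₀)) ⟨
      χ (pattern₄ xs ys t D₀₀ D₀₀ D₀₀)
        ≡⟨ χ-cong (pattern₄ xs ys t D₁₀ D₀₁ D₀₀) (pattern₄ xs ys t D₀₀ D₀₀ D₀₀)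
             (λ v v₁₂ χ≼v → let e₁₀ , e₀₁ = confused v v₁₂ χ≼v in
             trans (val-pattern₄ (proj₁ v₁₂) refl e₁₀ e₀₁ refl)
                   (sym (val-pattern₄ (proj₁ v₁₂) refl refl refl refl))) ⟨
      χ (pattern₄ xs ys t D₁₀ D₀₁ D₀₀)
        ≡⟨ cong₂ _∧_
             (val-pattern₄ u₁ (cong proj₁ ht) (cong proj₁ h₁₀) (cong proj₁ h₀₁) (cong proj₁ h₀₀))
             (val-pattern₄ w₁ (cong proj₂ ht) (cong proj₂ h₁₀) (cong proj₂ h₀₁) (cong proj₂ h₀₀)) ⟩
      f (zipWith (cases true true false false) xs ys) ∧
      f (zipWith (cases true false true false) xs ys)
        ≡⟨ cong₂ (λ xs′ ys′ → f xs′ ∧ f ys′)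
             (trans (zipWith-cong (cases-η λ x _ → x) xs ys) (zipWith-const xs ys))
             (trans (zipWith-cong (cases-η λ _ y → y) xs ys) (zipWith-flip-const xs ys)) ⟩
      f xs ∧ f ys ∎
      where
      open ≡-Reasoning

      collapsed : ∀ {v} → Respects K s₁ v → v t ≡ true → v D₀₀ ≡ false →
                  v (pattern₄ xs ys t D₀₀ D₀₀ D₀₀) ≡ f (zipWith _∧_ xs ys)
      collapsed v₁ vt v₀₀ = trans (val-pattern₄ v₁ vt v₀₀ v₀₀ v₀₀)
        (cong f (zipWith-cong (cases-η _∧_) xs ys))

  -- The split is read off the syntax of one argument. The three variable clauses realise the three
  -- false pairs for `false-at-ones⇒preserves-∧`; the clauses for `var 0` and `op` serve the nested
  -- `wrap`.
  share : F → Bool × Bool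
  share (var 0) = false , true
  share (var 1) = true , false
  share (var _) = false , false
  share (op _ _) = true , false

  share-false : ∀ A → meet (share A) ≡ false
  share-false (var 0)                 = refl
  share-false (var 1)                 = refl
  share-false (var (ℕ.suc (ℕ.suc _))) = refl
  share-false (op _ _)                = refl

  module _ (i : Fin (arity Σ s₂)) where

    -- All variables are true, so every formula s₂ (pⱼ , … , pⱼ) is false.
    false-at-ones⇒preserves-∧ : g (replicate _ true) ≡ false → Preserves _∧_ f
    false-at-ones⇒preserves-∧ g1 =
      confusion⇒preserves-∧ {var 0} {D 1} {D 0} {D 2} refl (h-D 1) (h-D 0) (h-D 2)
        λ v v₁₂ χ≼v → let v-D j = trans (proj₂ v₁₂ _) (D-false j (χ≼v (var j) refl)) in
          trans (v-D 1) (sym (v-D 2)) , trans (v-D 0) (sym (v-D 2))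
      where
      open Pair (λ _ → true , true) (λ As → share (lookup As i)) (λ As → share-false (lookup As i))

      D : ℕ → F
      D j = op s₂ (replicate _ (var j))

      D-false : ∀ {v : F → Bool} j → v (var j) ≡ true →
                g (map v (replicate _ (var j))) ≡ false
      D-false {v} j vj = trans (cong g (trans (map-replicate v (var j) _) (cong (replicate _) vj))) g1

      h-D : ∀ j → h (D j) ≡ share (var j)
      h-D j = trans (h-op₂ _) (trans
        (cong (λ b → if b then (true , true) else share (lookup (replicate _ (var j)) i))
              (D-false {χ} j refl))
        (cong share (lookup-replicate i (var j))))

    -- If t is true then wrap A is equivalent to A.
    true-at-ones⇒preserves-∧ : ∀ {b} → g (replicate _ true) ≡ true → g b ≡ false →
                               lookup b i ≡ false → Preserves _∧_ f
    true-at-ones⇒preserves-∧ {b} g1 gb bᵢ =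
      confusion⇒preserves-∧ {var 1} {wrap (wrap (var 0))} {wrap (var 0)} {var 0} refl
        (h-wrap (wrap (var 0)) (cong meet (h-wrap (var 0) refl))) (h-wrap (var 0) refl) refl
        λ v v₁₂ χ≼v → let v-wrap′ = λ A → v-wrap (proj₂ v₁₂) (χ≼v (var 1) refl) A in
          trans (v-wrap′ (wrap (var 0))) (v-wrap′ (var 0)) , v-wrap′ (var 0)
      where
      env : ℕ → Bool × Bool
      env 0 = false , false
      env _ = true , true

      open Pair env (λ As → share (lookup As i)) (λ As → share-false (lookup As i))

      -- The value of `A` decides between the all-true vector and `b` as arguments of `g`. As `b` is
      -- false at `i`, the argument inspected by `share` is `A` itself.
      wrap : F → F
      wrap A = op s₂ (map (λ β → if β then var 1 else A) b)

      v-wrap : ∀ {v} → Respects K s₂ v → v (var 1) ≡ true → ∀ A → v (wrap A) ≡ v A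
      v-wrap {v} v₂ vt A with v A in vA
      ... | true = trans (v₂ _) (trans
          (cong g (trans (sym (map-∘ v _ b)) (trans (map-cong all-true b) (map-const b true)))) g1)
        where
        all-true : ∀ β → v (if β then var 1 else A) ≡ true
        all-true true  = vt
        all-true false = vA
      ... | false = trans (v₂ _) (trans
          (cong g (trans (sym (map-∘ v _ b)) (trans (map-cong same b) (map-id b)))) gb)
        where
        same : ∀ β → v (if β then var 1 else A) ≡ β
        same true  = vt
        same false = vA

      h-wrap : ∀ A → χ A ≡ false → h (wrap A) ≡ share A
      h-wrap A χA = trans (h-op₂ _) (cong₂ (λ b′ A′ → if b′ then (true , true) else share A′)
        (trans (sym (χ₂ _)) (trans (v-wrap χ₂ refl A) χA))
        (trans (lookup-map i _ b) (cong (λ β → if β then var 1 else A) bᵢ)))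

  preserves-∧ : Fin (arity Σ s₂) → ∀ {b} → g b ≡ false → Preserves _∧_ f
  preserves-∧ i {b} gb with g (replicate _ true) in g1 | all-true-or-false-at b
  ... | false | _              = false-at-ones⇒preserves-∧ i g1
  ... | true  | inj₁ refl      = contradiction gb (true≢false g1)
  -- The inspected place must be one where `b` is false, so `i₀` replaces `i`.
  ... | true  | inj₂ (i₀ , bᵢ) = true-at-ones⇒preserves-∧ i₀ g1 gb bᵢ

  module ConstantFalse (g-false : ∀ xs → g xs ≡ false) where

    private
      -- `t` will be true in both valuations, `p` only in `w` and ⊥ only in `u`: the meet refutes
      -- `p` and ⊥, but neither valuation refutes both.
      env : ℕ → Bool × Bool
      env 0 = true , true
      env _ = false , true

    open Pair env (λ _ → true , false) (λ _ → refl)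

    private
      t p ⊥ᶠ : F
      t  = var 0
      p  = var 1
      ⊥ᶠ = op s₂ (replicate _ t)

    h-⊥ : h ⊥ᶠ ≡ (true , false)
    h-⊥ = trans (h-op₂ _) (cong (λ b → if b then (true , true) else (true , false)) (g-false _))

    u-⊥ : u ⊥ᶠ ≡ true
    u-⊥ = cong proj₁ h-⊥

    w-⊥ : w ⊥ᶠ ≡ false
    w-⊥ = cong proj₂ h-⊥

    -- A transfer principle: what holds whenever ⊥ is false also holds in `u`, where ⊥ is true.
    u-valid : ∀ E → (∀ v → V v → v t ≡ true → v ⊥ᶠ ≡ false → v E ≡ true) → u E ≡ true
    u-valid E E-valid = ∧-conicalˡ (u E) _ (χ-valid {E} λ v v₁₂ χ≼v →
      E-valid v v₁₂ (χ≼v t refl) (trans (proj₂ v₁₂ _) (g-false _)))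

    -- Excluding `p` from the meet gives a joint valuation in which ⊥ and `p` are both false, while
    -- everything true in both `u` and `w` stays true.
    model : ∀ E → u E ≡ true → w E ≡ true →
            ∃[ v ] (V v × v t ≡ true × v ⊥ᶠ ≡ false × v p ≡ false × v E ≡ true)
    model E uE wE =
      let v , v₁₂ , χ≼v , vp = excluding {p} refl
      in v , v₁₂ , χ≼v t refl , trans (proj₂ v₁₂ _) (g-false _) , vp , χ≼v E (cong₂ _∧_ uE wE)

    module _ (xs ys : Vec Bool (arity Σ s₁)) where

      ⟪_,_,_,_⟫ : Bool → Bool → Bool → Bool → Bool
      ⟪ a , b , c , d ⟫ = f (zipWith (cases a b c d) xs ys)

      true-at-ones : ⟪ true , false , false , false ⟫ ≡ true → ⟪ true , true , true , true ⟫ ≡ true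
      true-at-ones f∧ = trans (sym (val-pattern₄ u₁ refl u-⊥ u-⊥ u-⊥))
        (u-valid (pattern₄ xs ys t ⊥ᶠ ⊥ᶠ ⊥ᶠ) λ v v₁₂ vt v⊥ →
          trans (val-pattern₄ (proj₁ v₁₂) vt v⊥ v⊥ v⊥) f∧)

      -- The premises cover both values of `p`, so the pattern `t`, ⊥, `p`, `p` is valid; in `u` it
      -- reads true, true, false, false.
      meet⇒left : ⟪ true , false , true , true ⟫ ≡ true →
                  ⟪ true , false , false , false ⟫ ≡ true → ⟪ true , true , false , false ⟫ ≡ true
      meet⇒left f⇒ f∧ = trans (sym (val-pattern₄ u₁ refl u-⊥ refl refl))
        (u-valid (pattern₄ xs ys t ⊥ᶠ p p) λ v v₁₂ vt v⊥ →
          trans (val-pattern₄ (proj₁ v₁₂) vt v⊥ refl refl) (either (v p)))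
        where
        either : ∀ b → ⟪ true , false , b , b ⟫ ≡ true
        either true  = f⇒
        either false = f∧

      -- The pattern `t`, `p`, ⊥, ⊥ has the two premises as its values in `u` and `w`, and the
      -- conclusion as its value in the joint model.
      left⇒meet : ⟪ true , false , true , true ⟫ ≡ true →
                  ⟪ true , true , false , false ⟫ ≡ true → ⟪ true , false , false , false ⟫ ≡ true
      left⇒meet f⇒ fˡ =
        let v , v₁₂ , vt , v⊥ , vp , vE = model (pattern₄ xs ys t p ⊥ᶠ ⊥ᶠ)
              (trans (val-pattern₄ u₁ refl refl u-⊥ u-⊥) f⇒)
              (trans (val-pattern₄ w₁ refl refl w-⊥ w-⊥) fˡ)
        in trans (sym (val-pattern₄ (proj₁ v₁₂) vt vp v⊥ v⊥)) vE

    -- Where f is not monotone, it defines ↔ with the help of t.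
    module DefinableIff (xs ys : Vec Bool (arity Σ s₁))
                        (f∧ : f (zipWith (cases true false false false) xs ys) ≡ true)
                        (fˡ : f (zipWith (cases true true false false) xs ys) ≡ false) where

      table : ∀ a b → f (zipWith (cases true a b b) xs ys) ≡ a ↔ b
      table true  true  = true-at-ones xs ys f∧
      table true  false = fˡ
      table false true  = ¬-not λ f⇒ → true≢false (meet⇒left xs ys f⇒ f∧) fˡ
      table false false = f∧

      _↔ᶠ_ : F → F → F
      A ↔ᶠ B = pattern₄ xs ys t A B B

      val-↔ᶠ : ∀ {v A B a b} → Respects K s₁ v → v t ≡ true → v A ≡ a → v B ≡ b →
               v (A ↔ᶠ B) ≡ a ↔ b
      val-↔ᶠ v₁ vt vA vB = trans (val-pattern₄ v₁ vt vA vB vB) (table _ _)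

      -- The formulas ⊥, p and ⊥ ↔ p take the values 1, 0, 0 under u and
      -- 0, 1, 0 under w, and 0, 0, 1 under every joint valuation refuting p.
      iff-preserved : ∀ x y → f (zipWith _↔_ x y) ≡ f x ↔ f y
      iff-preserved x y = begin
        f (zipWith _↔_ x y)   ≡⟨ cong f (zipWith-cong (cases-η _↔_) x y) ⟨
        -- Among the values of `G` at the three unit vectors, any two true ones force the third and
        -- not all are false, so an odd number of them is true.
        G false false true    ≡⟨ odd _ _ _ ⊥,p,q ⊥,q,p q,⊥,p all-false ⟩
        G true false false ↔ G false true false
          ≡⟨ cong₂ (λ x′ y′ → f x′ ↔ f y′)
               (trans (zipWith-cong (cases-η λ x _ → x) x y) (zipWith-const x y))
               (trans (zipWith-cong (cases-η λ _ y → y) x y) (zipWith-flip-const x y)) ⟩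
        f x ↔ f y ∎
        where
        open ≡-Reasoning

        G : Bool → Bool → Bool → Bool
        G a b c = f (zipWith (cases true a b c) x y)

        q : F
        q = ⊥ᶠ ↔ᶠ p

        u-q : u q ≡ false
        u-q = val-↔ᶠ u₁ refl u-⊥ refl

        w-q : w q ≡ false
        w-q = val-↔ᶠ w₁ refl w-⊥ refl

        ⊥,p,q : G true false false ≡ true → G false true false ≡ true → G false false true ≡ true
        ⊥,p,q α β =
          let v , (v₁ , _) , vt , v⊥ , vp , vE = model (pattern₄ x y t ⊥ᶠ p q)
                (trans (val-pattern₄ u₁ refl u-⊥ refl u-q) α)
                (trans (val-pattern₄ w₁ refl w-⊥ refl w-q) β)
          in trans (sym (val-pattern₄ v₁ vt v⊥ vp (val-↔ᶠ v₁ vt v⊥ vp))) vE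

        ⊥,q,p : G true false false ≡ true → G false false true ≡ true → G false true false ≡ true
        ⊥,q,p α γ =
          let v , (v₁ , _) , vt , v⊥ , vp , vE = model (pattern₄ x y t ⊥ᶠ q p)
                (trans (val-pattern₄ u₁ refl u-⊥ u-q refl) α)
                (trans (val-pattern₄ w₁ refl w-⊥ w-q refl) γ)
          in trans (sym (val-pattern₄ v₁ vt v⊥ (val-↔ᶠ v₁ vt v⊥ vp) vp)) vE

        q,⊥,p : G false true false ≡ true → G false false true ≡ true → G true false false ≡ true
        q,⊥,p β γ =
          let v , (v₁ , _) , vt , v⊥ , vp , vE = model (pattern₄ x y t q ⊥ᶠ p)
                (trans (val-pattern₄ u₁ refl u-q u-⊥ refl) β)
                (trans (val-pattern₄ w₁ refl w-q w-⊥ refl) γ)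
          in trans (sym (val-pattern₄ v₁ vt (val-↔ᶠ v₁ vt v⊥ vp) v⊥ vp)) vE

        -- The pattern fails in `u` and `w`, so it is joined by `↔ᶠ` to `q`, also false in both, to
        -- become true there. In the joint model `q` is true, and the pattern with it.
        all-false : G false true false ≡ false → G false false true ≡ false →
                    G true false false ≡ true
        all-false β γ =
          let v , (v₁ , _) , vt , v⊥ , vp , vE = model (pattern₄ x y t q ⊥ᶠ p ↔ᶠ q)
                (val-↔ᶠ u₁ refl (trans (val-pattern₄ u₁ refl u-q u-⊥ refl) β) u-q)
                (val-↔ᶠ w₁ refl (trans (val-pattern₄ w₁ refl w-q w-⊥ refl) γ) w-q)
              vq = val-↔ᶠ v₁ vt v⊥ vp
          in trans (sym (↔-identityʳ _))
                   (trans (sym (val-↔ᶠ v₁ vt (val-pattern₄ v₁ vt vq v⊥ vp) vq)) vE)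

        odd : ∀ α β γ → (α ≡ true → β ≡ true → γ ≡ true) → (α ≡ true → γ ≡ true → β ≡ true) →
              (β ≡ true → γ ≡ true → α ≡ true) → (β ≡ false → γ ≡ false → α ≡ true) → γ ≡ α ↔ β
        odd true  true  γ     h _ _ _ = h refl refl
        odd true  false true  _ h _ _ = sym (h refl refl)
        odd true  false false _ _ _ _ = refl
        odd false true  true  _ _ h _ = sym (h refl refl)
        odd false true  false _ _ _ _ = refl
        odd false false true  _ _ _ _ = refl
        odd false false false _ _ _ h = h refl refl

    -- Otherwise f is monotone.
    preserves-∧-or-↔ : ExcludedMiddle 0ℓ → Preserves _∧_ f ⊎ Preserves _↔_ f
    preserves-∧-or-↔ em
      with em {∃[ xs ] ∃[ ys ] (f (zipWith _∧_ xs ys) ≡ true × f xs ≡ false)}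
    ... | yes (xs , ys , f∧ , fˡ) = inj₂ (DefinableIff.iff-preserved xs ys
        (trans (cong f (zipWith-cong (cases-η _∧_) xs ys)) f∧)
        (trans (cong f (trans (zipWith-cong (cases-η λ x _ → x) xs ys) (zipWith-const xs ys))) fˡ))
    ... | no ¬drop = inj₁ λ xs ys → by-truth
        (λ f∧ → cong₂ _∧_ (monotone xs ys f∧)
          (monotone ys xs (trans (cong f (zipWith-comm ∧-comm ys xs)) f∧)))
        -- `xs ⇒ ys` lies above `ys`, so monotonicity makes `f` true there; together with `f xs`
        -- this feeds `left⇒meet`.
        (λ fˡ∧fʳ → trans (cong f (sym (zipWith-cong (cases-η _∧_) xs ys)))
          (left⇒meet xs ys
            (trans (cong f (zipWith-cong (cases-η _⇒_) xs ys))
              (monotone (zipWith _⇒_ xs ys) ys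
                (trans (cong f (⇒-∧-absorb xs ys)) (∧-conicalʳ _ _ fˡ∧fʳ))))
            (trans (cong f (trans (zipWith-cong (cases-η λ x _ → x) xs ys) (zipWith-const xs ys)))
              (∧-conicalˡ _ _ fˡ∧fʳ))))
      where
      monotone : ∀ xs ys → f (zipWith _∧_ xs ys) ≡ true → f xs ≡ true
      monotone xs ys f∧ = ¬-not λ fˡ → ¬drop (xs , ys , f∧ , fˡ)

  -- An argument place of `s₂` would force `f` to preserve meets, against its being very
  -- significant. So `s₂` is nullary, and its one value is false.
  iff-and-⊥ : ExcludedMiddle 0ℓ → ¬ NotVerySignificant f → ∃[ b ] g b ≡ false →
              Preserves _↔_ f × arity Σ s₂ ≡ 0 × (∀ xs → g xs ≡ false)
  iff-and-⊥ em f-vs (b , gb) with inhabited-or-empty (arity Σ s₂)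
    where
    inhabited-or-empty : ∀ n → Fin n ⊎ n ≡ 0
    inhabited-or-empty ℕ.zero    = inj₂ refl
    inhabited-or-empty (ℕ.suc n) = inj₁ Fin.zero
  ... | inj₁ i       =
    contradiction (preserves-∧⇒not-very-significant f (preserves-∧ i gb)) f-vs
  ... | inj₂ nullary = f-↔ , nullary , g-false
    where
    g-false : ∀ xs → g xs ≡ false
    g-false xs = trans (cong g (Vec-0-unique nullary xs b)) gb

    f-↔ : Preserves _↔_ f
    f-↔ = Sum.[ (λ f-∧ → contradiction (preserves-∧⇒not-very-significant f f-∧) f-vs) , id ]
            (ConstantFalse.preserves-∧-or-↔ g-false em)

-- Kinds of connectives in terms of their interpretation

module _ (c : Connective) where

  private
    f = interp c
    c⟨p⟩ = op {signature ⟨ c ⟩} tt (tabulate (λ j → var (toℕ j)))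

  val-c⟨p⟩ : (v : Valuation ⟨ c ⟩) → val v c⟨p⟩ ≡ f (tabulate (λ j → val v (var (toℕ j))))
  val-c⟨p⟩ v = trans (val-op v tt _) (cong f (sym (tabulate-∘ (val v) _)))

  -- The default `d` is the value of the extra variable in `BottomLike`, where it is set to `false`
  -- to refute the conclusion.
  extend : Vec Bool k → Bool → ℕ → Bool
  extend []       d _         = d
  extend (x ∷ xs) d ℕ.zero    = x
  extend (x ∷ xs) d (ℕ.suc i) = extend xs d i

  extend-lookup : (xs : Vec Bool k) (d : Bool) (j : Fin k) → extend xs d (toℕ j) ≡ lookup xs j
  extend-lookup (x ∷ xs) d Fin.zero    = refl
  extend-lookup (x ∷ xs) d (Fin.suc j) = extend-lookup xs d j

  extend-beyond : (xs : Vec Bool k) (d : Bool) → extend xs d k ≡ d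
  extend-beyond []       d = refl
  extend-beyond (x ∷ xs) d = extend-beyond xs d

  assignment : Vec Bool (places c) → Bool → Valuation ⟨ c ⟩
  assignment xs d = record { val = para ; val-op = λ _ As → cong f (para*≡map As) }
    where open Para {signature ⟨ c ⟩} (extend xs d) (λ _ _ → f)

  assignment-c⟨p⟩ : ∀ xs d → val (assignment xs d) c⟨p⟩ ≡ f xs
  assignment-c⟨p⟩ xs d = trans (val-c⟨p⟩ (assignment xs d))
    (cong f (trans (tabulate-cong (extend-lookup xs d)) (tabulate∘lookup xs)))

  topLike⇒true : TopLike c → ∀ xs → f xs ≡ true
  topLike⇒true top xs = trans (sym (assignment-c⟨p⟩ xs true)) (top (assignment xs true) λ ())

  true⇒topLike : (∀ xs → f xs ≡ true) → TopLike c
  true⇒topLike f-true v _ = trans (val-c⟨p⟩ v) (f-true _)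

  bottomLike⇒false : BottomLike c → ∀ xs → f xs ≡ false
  bottomLike⇒false bot xs = ¬-not λ fxs → true≢false
    (bot (assignment xs false) λ { refl → trans (assignment-c⟨p⟩ xs false) fxs })
    (extend-beyond xs false)

  false⇒bottomLike : (∀ xs → f xs ≡ false) → BottomLike c
  false⇒bottomLike f-false v v⊨ =
    contradiction (trans (val-c⟨p⟩ v) (f-false _)) (true≢false (v⊨ refl))

  projectionConjunction⇒conjunction : ProjectionConjunction c → ∃ (IsConjunction f)
  projectionConjunction⇒conjunction (J , c⊨p , p⊨c) = J , λ xs → mk⇔
    (λ fxs j j∈J → trans (sym (extend-lookup xs true j))
      (c⊨p j (lookup⇒[]= j J j∈J) (assignment xs true)
        λ { refl → trans (assignment-c⟨p⟩ xs true) fxs }))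
    (λ h → trans (sym (assignment-c⟨p⟩ xs true))
      (p⊨c (assignment xs true) λ { (j , j∈J , refl) →
        trans (extend-lookup xs true j) (h j ([]=⇒lookup j∈J)) }))

  conjunction⇒projectionConjunction : ∃ (IsConjunction f) → ProjectionConjunction c
  conjunction⇒projectionConjunction (J , conj) = J
    , (λ j j∈J v v⊨ → trans (sym (lookup∘tabulate _ j))
        (Equivalence.to (conj _) (trans (sym (val-c⟨p⟩ v)) (v⊨ refl)) j ([]=⇒lookup j∈J)))
    , (λ v v⊨ → trans (val-c⟨p⟩ v) (Equivalence.from (conj _) λ j j∈J →
        trans (lookup∘tabulate _ j) (v⊨ (j , lookup⇒[]= j J j∈J , refl))))

  verySignificant⇒ : VerySignificant c → ¬ NotVerySignificant f
  verySignificant⇒ (¬bot , ¬conj) =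
    Sum.[ ¬bot ∘ false⇒bottomLike , ¬conj ∘ conjunction⇒projectionConjunction ]

  ¬verySignificant⇒ : ExcludedMiddle 0ℓ → ¬ VerySignificant c → NotVerySignificant f
  ¬verySignificant⇒ em ¬vs with em {BottomLike c} | em {ProjectionConjunction c}
  ... | yes bot | _        = inj₁ (bottomLike⇒false bot)
  ... | no _    | yes conj = inj₂ (projectionConjunction⇒conjunction conj)
  ... | no ¬bot | no ¬conj = contradiction (¬bot , ¬conj) ¬vs

  ¬topLike⇒ : ExcludedMiddle 0ℓ → ¬ TopLike c → ∃[ xs ] f xs ≡ false
  ¬topLike⇒ em ¬top with em {∃[ xs ] f xs ≡ false}
  ... | yes found = found
  ... | no  none  = contradiction (true⇒topLike λ xs → ¬-not λ fxs → none (xs , fxs)) ¬top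

theorem2 : ExcludedMiddle (suc 0ℓ) → (c₁ c₂ : Connective) →
    ((𝓑 ⟨ c₁ ⟩ • 𝓑 ⟨ c₂ ⟩) ≋ 𝓑 (⟨ c₁ ⟩ ∪ᶜ ⟨ c₂ ⟩))
    ⇔
    ( (TopLike c₁ ⊎ TopLike c₂)
    ⊎ (¬ VerySignificant c₁ × ¬ VerySignificant c₂)
    ⊎ ((c₁ ∈𝒞↔ × Is⊥ c₂) ⊎ (Is⊥ c₁ × c₂ ∈𝒞↔)) )
theorem2 em c₁ c₂ = mk⇔ (necessity ∘ ≋⇒meet-complete) (meet-complete⇒≋ ∘ sufficiency)
  where
  open Classical em
  open Criterion c₁ c₂

  K : Connectives
  K = ⟨ c₁ ⟩ ∪ᶜ ⟨ c₂ ⟩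

  Condition : Set
  Condition = (TopLike c₁ ⊎ TopLike c₂)
            ⊎ (¬ VerySignificant c₁ × ¬ VerySignificant c₂)
            ⊎ ((c₁ ∈𝒞↔ × Is⊥ c₂) ⊎ (Is⊥ c₁ × c₂ ∈𝒞↔))

  necessity : MeetComplete K (inj₁ tt) (inj₂ tt) → Condition
  necessity complete
    with em₀ {TopLike c₁} | em₀ {TopLike c₂} | em₀ {VerySignificant c₁} | em₀ {VerySignificant c₂}
  ... | yes top₁ | _        | _       | _       = inj₁ (inj₁ top₁)
  ... | no _     | yes top₂ | _       | _       = inj₁ (inj₂ top₂)
  ... | no _     | no _     | no ¬vs₁ | no ¬vs₂ = inj₂ (inj₁ (¬vs₁ , ¬vs₂))
  ... | no _     | no ¬top₂ | yes vs₁ | _       =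
    let f-↔ , g-⊥ = Necessity.iff-and-⊥ K (∪ᶜ-splits {c₁} {c₂}) complete em₀
                      (verySignificant⇒ c₁ vs₁) (¬topLike⇒ c₂ em₀ ¬top₂)
    in inj₂ (inj₂ (inj₁ (preserves-↔⇒∈𝒞↔ c₁ f-↔ , g-⊥)))
  -- The same argument with the two connectives exchanged.
  ... | no ¬top₁ | no _     | no _    | yes vs₂ =
    let g-↔ , f-⊥ = Necessity.iff-and-⊥ K (splits-sym (∪ᶜ-splits {c₁} {c₂}))
                      (meet-complete-sym K complete) em₀
                      (verySignificant⇒ c₂ vs₂) (¬topLike⇒ c₁ em₀ ¬top₁)
    in inj₂ (inj₂ (inj₂ (f-⊥ , preserves-↔⇒∈𝒞↔ c₂ g-↔)))

  sufficiency : Condition → MeetComplete K (inj₁ tt) (inj₂ tt)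
  sufficiency (inj₁ (inj₁ top₁)) =
    meet-complete-sym K (constant-true⇒meet-complete K (topLike⇒true c₁ top₁))
  sufficiency (inj₁ (inj₂ top₂)) = constant-true⇒meet-complete K (topLike⇒true c₂ top₂)
  sufficiency (inj₂ (inj₁ (¬vs₁ , ¬vs₂))) = not-very-significant⇒meet-complete K
    (¬verySignificant⇒ c₁ em₀ ¬vs₁) (¬verySignificant⇒ c₂ em₀ ¬vs₂)
  sufficiency (inj₂ (inj₂ (inj₁ (c₁∈ , nullary , g-false)))) =
    ↔-⊥⇒meet-complete K (∈𝒞↔⇒preserves-↔ c₁ c₁∈) nullary g-false
  sufficiency (inj₂ (inj₂ (inj₂ ((nullary , f-false) , c₂∈)))) =
    meet-complete-sym K (↔-⊥⇒meet-complete K (∈𝒞↔⇒preserves-↔ c₂ c₂∈) nullary f-false)
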